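{- Let $G_{\mathrm{cyc}}=(\{x,y,z,e\},R,\mathrm{KSO})$ with $R(x_j)=q^jy_jx_{j+1}$, $R(y_j)=q^jy_jx_{j+1}$, $R(z_j)=q^jy_jx_{j+1}$, $R(e_j)=\beta q^je_jz_{j+1}$, with $q$-derivative $D$, and let $\phi(x_j)=x$, $\phi(y_j)=y$, $\phi(z_j)=z$, $\phi(e_j)=e$. Then $$\phi\big(\mathrm{Gen}_q^{(G_{\mathrm{cyc}})}(e_0;u)\big)=e\prod_{k=0}^{\infty}\frac{1}{1-\beta uq^k\,\phi\big(\mathrm{Gen}_q^{(G_{\mathrm{cyc}})}(z_1;uq^k)\big)},$$ where $$\phi\big(\mathrm{Gen}_q^{(G_{\mathrm{cyc}})}(z_1;uq^k)\big)=\frac{z-y+x^{ -1}y(x-z)\,e_q\big((x-y)uq^{k+1}\big)}{1-x^{ -1}y\,e_q\big((x-y)uq^{k+1}\big)}.$$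
   Context: $\mathbb{K}$ is a commutative ring with unity of characteristic zero containing $\beta$ (e.g. $\mathbb{Q}[\beta]$), $q$ an indeterminate. Variables $x_i,y_i,z_i,e_i$ ($i\ge0$) form $\mathbb{S}$; $\mathbb{E}=\mathbb{K}[q][F(\mathbb{S})]$ is the group algebra of the free group on $\mathbb{S}$. $R$ is extended to inverses by $R(s_i^{ -1})=-s_i^{ -1}R(s_i)s_{i+1}^{ -1}$; $\uparrow$ replaces every letter $s_i^{\pm1}$ by $s_{i+1}^{\pm1}$; KSO is the identity order. The $q$-derivative is the $\mathbb{K}[q]$-linear map $D(w_1\cdots w_n)=\sum_{j=1}^nw_1\cdots w_{j-1}R(w_j)\uparrow(w_{j+1}\cdots w_n)$, $D^n$ its iterate. $\phi$ extends to a $\mathbb{K}[q]$-algebra homomorphism with $\phi(s_i^{ -1})=\phi(s_i)^{ -1}$. $(a;q)_n=\prod_{j=0}^{n-1}(1-aq^j)$; $\mathrm{Gen}_q^{(G)}(f;u)=\sum_{n\ge0}D^n(f)\frac{u^n}{(q;q)_n}$, $\phi$ applied coefficientwise, and $\phi(\mathrm{Gen}(f;uq^k))$ denotes substitution $u\mapsto uq^k$; $e_q(u)=\sum_{n\ge0}\frac{u^n}{(q;q)_n}$. -}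

module Defs where

open import Level using (Level)
open import Algebra.Bundles using (CommutativeRing)
open import Data.Nat as ℕ using (ℕ; zero; suc; _∸_; _<_)
open import Data.Integer as ℤ using (ℤ)
open import Data.Bool using (Bool; true; false; if_then_else_)
open import Data.List using (List; []; _∷_; _++_; map; concatMap; foldr)
open import Data.Product using (_×_; _,_)
open import Data.Product.Properties using (≡-dec)
open import Relation.Nullary using (Dec; yes; no; does)
open import Relation.Binary.PropositionalEquality using (_≡_)
open import Data.Empty using (⊥)

module _ {c ℓ : Level} (K : CommutativeRing c ℓ) where
  open CommutativeRing K
  natK : ℕ → Carrier
  natK zero = 0#
  natK (suc n) = 1# + natK n

CharZero : {c ℓ : Level} → CommutativeRing c ℓ → Set ℓ
CharZero K = ∀ (n : ℕ) → CommutativeRing._≈_ K (natK K (suc n)) (CommutativeRing.0# K) → ⊥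

data Sym : Set where
  X Y Z E : Sym

record Letter : Set where
  constructor lt
  field
    sym : Sym
    idx : ℕ
    inv : Bool

Word : Set
Word = List Letter

up : Word → Word
up = map (λ { (lt s j b) → lt s (suc j) b })

-- exponent vectors of Laurent monomials x^a y^b z^c e^d
Exp : Set
Exp = ℤ × ℤ × ℤ × ℤ

_≟E_ : (a b : Exp) → Dec (a ≡ b)
_≟E_ = ≡-dec ℤ._≟_ (≡-dec ℤ._≟_ (≡-dec ℤ._≟_ ℤ._≟_))

_+E_ : Exp → Exp → Exp
(a , b , c , d) +E (a' , b' , c' , d') = (a ℤ.+ a') , (b ℤ.+ b') , (c ℤ.+ c') , (d ℤ.+ d')

0E : Exp
0E = ℤ.0ℤ , ℤ.0ℤ , ℤ.0ℤ , ℤ.0ℤ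

letterExp : Letter → Exp
letterExp (lt s _ b) = go s (if b then ℤ.-1ℤ else ℤ.1ℤ)
  where
  go : Sym → ℤ → Exp
  go X k = k , ℤ.0ℤ , ℤ.0ℤ , ℤ.0ℤ
  go Y k = ℤ.0ℤ , k , ℤ.0ℤ , ℤ.0ℤ
  go Z k = ℤ.0ℤ , ℤ.0ℤ , k , ℤ.0ℤ
  go E k = ℤ.0ℤ , ℤ.0ℤ , ℤ.0ℤ , k

wordExp : Word → Exp
wordExp = foldr (λ l acc → letterExp l +E acc) 0E

module Cyc {c ℓ : Level} (K : CommutativeRing c ℓ) (β : CommutativeRing.Carrier K) where
  open CommutativeRing K

  -- The algebra 𝔼 = 𝕂[q][F(𝕊)]: formal 𝕂-linear combinations of
  -- terms  c · q^a · w  (w a word in the letters s_j^{±1}).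
  record Term : Set c where
    constructor tm
    field
      coef : Carrier
      qexp : ℕ
      word : Word

  Elm : Set c
  Elm = List Term

  scaleT : Carrier → ℕ → Term → Term
  scaleT a k (tm b j w) = tm (a * b) (k ℕ.+ j) w

  negE : Elm → Elm
  negE = map (scaleT (- 1#) 0)

  lmulW : Word → Elm → Elm
  lmulW w = map (λ { (tm b j v) → tm b j (w ++ v) })

  rmulW : Elm → Word → Elm
  rmulW f w = map (λ { (tm b j v) → tm b j (v ++ w) }) f

  Rgen : Sym → ℕ → Elm
  Rgen X j = tm 1# j (lt Y j false ∷ lt X (suc j) false ∷ []) ∷ []
  Rgen Y j = tm 1# j (lt Y j false ∷ lt X (suc j) false ∷ []) ∷ []
  Rgen Z j = tm 1# j (lt Y j false ∷ lt X (suc j) false ∷ []) ∷ []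
  Rgen E j = tm β j (lt E j false ∷ lt Z (suc j) false ∷ []) ∷ []

  R : Letter → Elm
  R (lt s j false) = Rgen s j
  R (lt s j true)  = negE (lmulW (lt s j true ∷ []) (rmulW (Rgen s j) (lt s (suc j) true ∷ [])))

  Dw : Word → Elm
  Dw [] = []
  Dw (a ∷ w) = rmulW (R a) (up w) ++ lmulW (a ∷ []) (Dw w)

  D : Elm → Elm
  D = concatMap (λ { (tm b j w) → map (scaleT b j) (Dw w) })

  Dⁿ : ℕ → Elm → Elm
  Dⁿ zero f = f
  Dⁿ (suc n) f = D (Dⁿ n f)

  -- Laurent polynomials 𝕂[x^±,y^±,z^±,e^±] as finite lists of
  -- (coefficient, exponent) pairs, compared coefficientwise.
  Lau : Set c
  Lau = List (Carrier × Exp)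

  coeffL : Lau → Exp → Carrier
  coeffL p m = foldr (λ { (a , m') acc → if does (m' ≟E m) then a + acc else acc }) 0# p

  _≈L_ : Lau → Lau → Set ℓ
  p ≈L p' = ∀ m → coeffL p m ≈ coeffL p' m

  _+L_ : Lau → Lau → Lau
  _+L_ = _++_

  _*L_ : Lau → Lau → Lau
  p *L p' = concatMap (λ { (a , m) → map (λ { (b , m') → (a * b , m +E m') }) p' }) p

  -L_ : Lau → Lau
  -L_ = map (λ { (a , m) → (- a , m) })

  monoL : Carrier → Exp → Lau
  monoL a m = (a , m) ∷ []

  1L : Lau
  1L = monoL 1# 0E

  dL : Lau
  dL = 1L +L monoL (- 1#) (ℤ.-1ℤ , ℤ.1ℤ , ℤ.0ℤ , ℤ.0ℤ)

  powL : Lau → ℕ → Lau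
  powL p zero = 1L
  powL p (suc n) = p *L powL p n

  -- Coefficient ring 𝒞 = 𝕂[x^±,y^±,z^±,e^±][(1 - x^{-1}y)^{-1}]:
  -- fractions p / d^k.
  record Frac : Set c where
    constructor _/d^_
    field
      num : Lau
      den : ℕ

  _≈C_ : Frac → Frac → Set ℓ
  (p /d^ k) ≈C (p' /d^ k') = (p *L powL dL k') ≈L (p' *L powL dL k)

  _+C_ : Frac → Frac → Frac
  (p /d^ k) +C (p' /d^ k') = ((p *L powL dL k') +L (p' *L powL dL k)) /d^ (k ℕ.+ k')

  _*C_ : Frac → Frac → Frac
  (p /d^ k) *C (p' /d^ k') = (p *L p') /d^ (k ℕ.+ k')

  -C_ : Frac → Frac
  -C (p /d^ k) = (-L p) /d^ k

  0C 1C : Frac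
  0C = [] /d^ 0
  1C = 1L /d^ 0

  sumC : ℕ → (ℕ → Frac) → Frac
  sumC zero f = 0C
  sumC (suc n) f = sumC n f +C f n

  -- Formal power series 𝒞[[u,q]]; a n m = coefficient of u^n q^m.
  Ser : Set c
  Ser = ℕ → ℕ → Frac

  _≈S_ : Ser → Ser → Set ℓ
  a ≈S b = ∀ n m → a n m ≈C b n m

  constS : Frac → Ser
  constS f zero zero = f
  constS f _ _ = 0C

  monoS : Frac → ℕ → ℕ → Ser
  monoS f i j n m with does (n ℕ.≟ i) | does (m ℕ.≟ j)
  ... | true | true = f
  ... | _    | _    = 0C

  0S 1S uS : Ser
  0S = constS 0C
  1S = constS 1C
  uS = monoS 1C 1 0

  qPow : ℕ → Ser
  qPow j = monoS 1C 0 j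

  _+S_ : Ser → Ser → Ser
  (a +S b) n m = a n m +C b n m

  -S_ : Ser → Ser
  (-S a) n m = -C (a n m)

  _-S_ : Ser → Ser → Ser
  a -S b = a +S (-S b)

  _*S_ : Ser → Ser → Ser
  (a *S b) n m = sumC (suc n) (λ i → sumC (suc m) (λ j → a i j *C b (n ∸ i) (m ∸ j)))

  powS : Ser → ℕ → Ser
  powS a zero = 1S
  powS a (suc t) = a *S powS a t

  -- Σ_{t ≥ 0} r^t for r with zero constant term (coefficient (n,m) only
  -- receives contributions from t ≤ n + m)
  geomS : Ser → Ser
  geomS r n m = sumC (suc (n ℕ.+ m)) (λ t → powS r t n m)

  -- inverse of a series a, given the inverse c of its constant term:
  -- a^{-1} = c · Σ_t (1 - c a)^t
  invWith : Frac → Ser → Ser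
  invWith c a = constS c *S geomS (1S -S (constS c *S a))

  -- Σ_{i ≥ 0} T i for a family with T i = O(u^i)
  sumU : (ℕ → Ser) → Ser
  sumU T n m = sumC (suc n) (λ i → T i n m)

  substU : ℕ → Ser → Ser
  substU k a n m with does (k ℕ.* n ℕ.≤? m)
  ... | true  = a n (m ∸ k ℕ.* n)
  ... | false = 0C

  qPoch : ℕ → Ser
  qPoch zero = 1S
  qPoch (suc n) = qPoch n *S (1S -S qPow (suc n))

  invQPoch : ℕ → Ser
  invQPoch n = invWith 1C (qPoch n)

  -- e_q(v) = Σ v^n/(q;q)_n   (for v = O(u))
  eq : Ser → Ser
  eq v = sumU (λ n → powS v n *S invQPoch n)

  φT : Term → Ser
  φT (tm b j w) = monoS (monoL b (wordExp w) /d^ 0) 0 j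

  φ : Elm → Ser
  φ = foldr (λ t acc → φT t +S acc) 0S

  φGen : Elm → Ser
  φGen f = sumU (λ n → φ (Dⁿ n f) *S (powS uS n *S invQPoch n))

  gen : Sym → ℕ → Elm
  gen s j = tm 1# 0 (lt s j false ∷ []) ∷ []

  symS : Sym → Ser
  symS s = φ (gen s 0)

  x⁻¹yS : Ser
  x⁻¹yS = constS (monoL 1# (ℤ.-1ℤ , ℤ.1ℤ , ℤ.0ℤ , ℤ.0ℤ) /d^ 0)

  βS : Ser
  βS = constS (monoL β 0E /d^ 0)

  closedForm : ℕ → Ser
  closedForm k = numer *S invWith (1L /d^ 1) denom
    where
    Eq = eq ((symS X -S symS Y) *S (uS *S qPow (suc k)))
    numer = (symS Z -S symS Y) +S (x⁻¹yS *S ((symS X -S symS Z) *S Eq))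
    denom = 1S -S (x⁻¹yS *S Eq)

  factor : ℕ → Ser
  factor k = invWith 1C (1S -S (βS *S (uS *S (qPow k *S substU k (φGen (gen Z 1))))))

  partialProd : ℕ → Ser
  partialProd zero = 1S
  partialProd (suc N) = partialProd N *S factor N

{-# OPTIONS --safe #-}
module Submission where

open import Defs
open import Algebra.Bundles using (CommutativeRing; RawRing)
open import Data.Bool using (true; false; if_then_else_) renaming (T to IsTrue)
open import Data.Empty using (⊥-elim)
open import Data.Integer as ℤ using (ℤ; 0ℤ; 1ℤ; -1ℤ)
open import Data.List using ([]; _∷_; _++_; map; length)
open import Data.List.Properties using (map-++; ++-assoc)
open import Data.Maybe using (Maybe; just; nothing)
open import Data.Nat as ℕ using (ℕ; zero; suc; _∸_; _≤_; _<_; z≤n; s≤s)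
open import Data.Product using (_×_; _,_; Σ)
open import Data.Unit using (tt)
open import Function using (_∘_)
open import Level using (Level; _⊔_)
open import Relation.Binary.Definitions using (tri<; tri≈; tri>)
open import Relation.Binary.PropositionalEquality as ≡ using (_≡_; _≢_)
open import Relation.Nullary using (Dec; yes; no; does; ¬_)
open import Relation.Nullary.Decidable using (dec-true; dec-false)
open import Algebra.Solver.Ring.AlmostCommutativeRing using (fromCommutativeRing; _-Raw-AlmostCommutative⟶_)
import Algebra.Properties.AbelianGroup
import Algebra.Properties.CommutativeSemiring.Exp
import Algebra.Properties.Ring
import Algebra.Properties.Semiring.Exp
import Algebra.Properties.Semiring.Mult.TCOptimised
import Algebra.Solver.Ring
import Data.Integer.Properties as ℤₚ
import Data.Nat.Properties as ℕₚ
import Data.Sign as Sign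
import Relation.Binary.Reasoning.Setoid as SetoidReasoning

-- The twisted derivative satisfies the Leibniz rule D(fg) = D(f)·↑g + f·D(g)
-- and D(↑f) = q·↑D(f), so the generating function γ_w(u) = φ(Gen(w; u)) of a
-- word obeys the q-difference equation γ_w(u) − γ_w(qu) = u·γ_{Dw}(u).  As
-- 1 − qⁿ is invertible for n ≥ 1, such an equation has at most one solution
-- with given constant term; hence γ_{vw} = γ_v·γ_w and γ_{↑w}(u) = γ_w(qu).
-- For the letters this gives, writing X, Y, Z, A for the series of x₀, y₀, z₀, e₀,
--   X(u) − X(qu) = Y(u) − Y(qu) = Z(u) − Z(qu) = u·Y(u)·X(qu),
--   A(u) − A(qu) = β·u·A(u)·Z(qu).
-- The first line makes X − Y and Z − Y constant.  With
-- Φ(u) = x⁻¹y·e_q((x − y)u) the defect F = X·Φ − Y satisfies a homogeneous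
-- equation F(qu)(1 + u·Y(u)) = F(u)(1 − (x − y)u) and F(0) = 0, so F = 0;
-- solving X·Φ = Y for Z is the closed form.  The second line reads
-- A(u)(1 − β·u·Z(qu)) = A(qu), and telescoping it gives the product.

-- `Φ` is what Y/X has to be: with a = x - y and Y = X - a, the shift σ : u ↦ qu gives Y/X - σ(Y/X)
-- = a(1/σX - 1/X) = u·a·(Y/X), and the solution with constant term x⁻¹y is x⁻¹y·e_q(au). Working
-- with X·Φ - Y avoids the division. Two obstacles lie outside the q-calculus. `D` does not descend
-- along `φ`, as it sees the order and the indices of letters; so `D` is transposed to an operator
-- on functions of words, and iterated on `φ`. And equality of fractions is cross-multiplication,
-- which is transitive only because 1 - x⁻¹y is not a zero divisor; as `K` may have zero divisors,
-- this needs its own argument. That element must be inverted because it is the constant term of the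
-- denominator of the closed form; every other inverted series has constant term 1. The infinite
-- product is a q-adic limit: the N-th partial product is compared in all q-degrees below N. The
-- q-calculus is done over an arbitrary coefficient ring and carried over to the lists and truncated
-- sums of the definitions at the end.

-- Integer coefficients let the ring solver cancel x − x in an abstract
-- ring, where equality of coefficients taken in the ring is undecidable.
module RingSolver {c ℓ : Level} (R : CommutativeRing c ℓ) where
  open import Data.Integer using (+_; -[1+_])
  open CommutativeRing R
  open Algebra.Properties.Ring ring
  open Algebra.Properties.Semiring.Mult.TCOptimised semiring renaming (_×_ to _·_)
  open SetoidReasoning setoid

  private
    ⟦_⟧ : ℤ → Carrier
    ⟦ + n ⟧      = n · 1#
    ⟦ -[1+ n ] ⟧ = - (suc n · 1#)

    ⟦-+⟧ : ∀ n → ⟦ ℤ.- (+ n) ⟧ ≈ - (n · 1#)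
    ⟦-+⟧ zero    = sym -0#≈0#
    ⟦-+⟧ (suc n) = refl

    ⊖-homo : ∀ m n → ⟦ m ℤ.⊖ n ⟧ ≈ m · 1# - n · 1#
    ⊖-homo m zero = sym (trans (+-congˡ -0#≈0#) (+-identityʳ _))
    ⊖-homo zero (suc n) = sym (+-identityˡ _)
    ⊖-homo (suc m) (suc n) = begin
      ⟦ suc m ℤ.⊖ suc n ⟧            ≡⟨ ≡.cong ⟦_⟧ (ℤₚ.[1+m]⊖[1+n]≡m⊖n m n) ⟩
      ⟦ m ℤ.⊖ n ⟧                    ≈⟨ ⊖-homo m n ⟩
      m · 1# - n · 1#                ≈⟨ +-congʳ (xyx⁻¹≈y 1# (m · 1#)) ⟨
      1# + m · 1# - 1# - n · 1#      ≈⟨ +-assoc _ _ _ ⟩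
      1# + m · 1# + (- 1# - n · 1#)  ≈⟨ +-congˡ (-‿+-comm _ _) ⟩
      1# + m · 1# - (1# + n · 1#)    ≈⟨ +-cong (1+× m 1#) (-‿cong (1+× n 1#)) ⟨
      suc m · 1# - suc n · 1#        ∎

    +-homo : ∀ i j → ⟦ i ℤ.+ j ⟧ ≈ ⟦ i ⟧ + ⟦ j ⟧
    +-homo (+ m) (+ n) = ×-homo-+ 1# m n
    +-homo (+ m) (-[1+ n ]) = ⊖-homo m (suc n)
    +-homo (-[1+ m ]) (+ n) = trans (⊖-homo n (suc m)) (+-comm _ _)
    +-homo (-[1+ m ]) (-[1+ n ]) = begin
      - (suc (suc (m ℕ.+ n)) · 1#)   ≡⟨ ≡.cong (λ k → - (k · 1#)) (≡.cong suc (≡.sym (ℕₚ.+-suc m n))) ⟩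
      - ((suc m ℕ.+ suc n) · 1#)     ≈⟨ -‿cong (×-homo-+ 1# (suc m) (suc n)) ⟩
      - (suc m · 1# + suc n · 1#)    ≈⟨ -‿+-comm _ _ ⟨
      - (suc m · 1#) - (suc n · 1#)  ∎

    *-homo : ∀ i j → ⟦ i ℤ.* j ⟧ ≈ ⟦ i ⟧ * ⟦ j ⟧
    *-homo (+ m) (+ n) = trans (reflexive (≡.cong ⟦_⟧ (ℤₚ.+◃n≡+n (m ℕ.* n)))) (×1-homo-* m n)
    *-homo (+ m) (-[1+ n ]) = begin
      ⟦ Sign.- ℤ.◃ m ℕ.* suc n ⟧   ≡⟨ ≡.cong ⟦_⟧ (ℤₚ.-◃n≡-n (m ℕ.* suc n)) ⟩
      ⟦ ℤ.- (+ (m ℕ.* suc n)) ⟧    ≈⟨ ⟦-+⟧ (m ℕ.* suc n) ⟩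
      - ((m ℕ.* suc n) · 1#)       ≈⟨ -‿cong (×1-homo-* m (suc n)) ⟩
      - (m · 1# * (suc n · 1#))    ≈⟨ -‿distribʳ-* _ _ ⟩
      m · 1# * - (suc n · 1#)      ∎
    *-homo (-[1+ m ]) (+ n) = begin
      ⟦ Sign.- ℤ.◃ suc m ℕ.* n ⟧   ≡⟨ ≡.cong ⟦_⟧ (ℤₚ.-◃n≡-n (suc m ℕ.* n)) ⟩
      ⟦ ℤ.- (+ (suc m ℕ.* n)) ⟧    ≈⟨ ⟦-+⟧ (suc m ℕ.* n) ⟩
      - ((suc m ℕ.* n) · 1#)       ≈⟨ -‿cong (×1-homo-* (suc m) n) ⟩
      - (suc m · 1# * (n · 1#))    ≈⟨ -‿distribˡ-* _ _ ⟩
      - (suc m · 1#) * (n · 1#)    ∎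
    *-homo (-[1+ m ]) (-[1+ n ]) = begin
      (suc m ℕ.* suc n) · 1#           ≈⟨ ×1-homo-* (suc m) (suc n) ⟩
      suc m · 1# * (suc n · 1#)        ≈⟨ -‿involutive _ ⟨
      - - (suc m · 1# * (suc n · 1#))  ≈⟨ -‿cong (-‿distribʳ-* _ _) ⟩
      - (suc m · 1# * - (suc n · 1#))  ≈⟨ -‿distribˡ-* _ _ ⟩
      - (suc m · 1#) * - (suc n · 1#)  ∎

    -‿homo : ∀ i → ⟦ ℤ.- i ⟧ ≈ - ⟦ i ⟧
    -‿homo (+ n)      = ⟦-+⟧ n
    -‿homo (-[1+ n ]) = sym (-‿involutive _)

    ℤ-rawRing : RawRing _ _
    ℤ-rawRing = record
      { Carrier = ℤ ; _≈_ = _≡_ ; _+_ = ℤ._+_ ; _*_ = ℤ._*_ ; -_ = ℤ.-_ ; 0# = ℤ.0ℤ ; 1# = ℤ.1ℤ }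

    morphism : ℤ-rawRing -Raw-AlmostCommutative⟶ fromCommutativeRing R
    morphism = record
      { ⟦_⟧ = ⟦_⟧ ; +-homo = +-homo ; *-homo = *-homo ; -‿homo = -‿homo ; 0-homo = refl ; 1-homo = refl }

    _≟_ : ∀ i j → Maybe (⟦ i ⟧ ≈ ⟦ j ⟧)
    i ≟ j with i ℤ.≟ j
    ... | yes i≡j = just (reflexive (≡.cong ⟦_⟧ i≡j))
    ... | no  _   = nothing

  open Algebra.Solver.Ring ℤ-rawRing (fromCommutativeRing R) morphism _≟_ public
    using (solve; _:=_; _:+_; _:*_; :-_; _:-_; con)

-- Finite sums and formal power series over a commutative ring.

module Sum {c ℓ : Level} (R : CommutativeRing c ℓ) where
  open CommutativeRing R hiding (zero)

  sum : ℕ → (ℕ → Carrier) → Carrier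
  sum zero f    = 0#
  sum (suc n) f = sum n f + f n

  sum-cong< : ∀ n {f g} → (∀ i → i < n → f i ≈ g i) → sum n f ≈ sum n g
  sum-cong< zero    f≈g = refl
  sum-cong< (suc n) f≈g = +-cong (sum-cong< n λ i i<n → f≈g i (ℕₚ.m≤n⇒m≤1+n i<n)) (f≈g n ℕₚ.≤-refl)

  sum-cong : ∀ n {f g} → (∀ i → f i ≈ g i) → sum n f ≈ sum n g
  sum-cong n f≈g = sum-cong< n λ i _ → f≈g i

  sum-zero : ∀ n {f} → (∀ i → i < n → f i ≈ 0#) → sum n f ≈ 0#
  sum-zero zero    f≈0 = refl
  sum-zero (suc n) f≈0 =
    trans (+-cong (sum-zero n λ i i<n → f≈0 i (ℕₚ.m≤n⇒m≤1+n i<n)) (f≈0 n ℕₚ.≤-refl)) (+-identityˡ _)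

  sum-last : ∀ n {f} → (∀ i → i < n → f i ≈ 0#) → sum (suc n) f ≈ f n
  sum-last n f≈0 = trans (+-congʳ (sum-zero n f≈0)) (+-identityˡ _)

  sum-first : ∀ n f → sum (suc n) f ≈ f 0 + sum n (f ∘ suc)
  sum-first zero f = +-comm _ _
  sum-first (suc n) f = trans (+-congʳ (sum-first n f)) (+-assoc _ _ _)

  sum-extend : ∀ {m n} f → m ℕ.≤′ n → (∀ i → m ≤ i → f i ≈ 0#) → sum n f ≈ sum m f
  sum-extend f ℕ.≤′-refl f≈0 = refl
  sum-extend f (ℕ.≤′-step m≤n) f≈0 =
    trans (+-cong (sum-extend f m≤n f≈0) (f≈0 _ (ℕₚ.≤′⇒≤ m≤n))) (+-identityʳ _)

module PowerSeries {c ℓ : Level} (R : CommutativeRing c ℓ) where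
  open CommutativeRing R hiding (zero)
  open RingSolver R
  open Sum R
  open SetoidReasoning setoid
  open Algebra.Properties.Ring ring using (-0#≈0#)
  open Algebra.Properties.Semiring.Exp semiring using (_^_)

  Series : Set c
  Series = ℕ → Carrier

  infix 4 _≋_
  -- A record, so that both series can be inferred from the type of a proof; a bare pointwise
  -- statement would not determine them.
  record _≋_ (a b : Series) : Set ℓ where
    constructor coeffwise
    field coeff : ∀ n → a n ≈ b n
  open _≋_ public

  -- The Cauchy product by recursion on the degree, passing to the tail of the first factor. The
  -- ring laws become inductions on n without subtraction of indices.
  conv : Series → Series → Series
  conv a b zero    = a 0 * b 0
  conv a b (suc n) = a 0 * b (suc n) + conv (a ∘ suc) b n

  conv-sum : ∀ n a b → conv a b n ≈ sum (suc n) (λ i → a i * b (n ∸ i))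
  conv-sum zero a b = sym (+-identityˡ _)
  conv-sum (suc n) a b = begin
    a 0 * b (suc n) + conv (a ∘ suc) b n
      ≈⟨ +-congˡ (conv-sum n (a ∘ suc) b) ⟩
    a 0 * b (suc n) + sum (suc n) (λ i → a (suc i) * b (n ∸ i))
      ≈⟨ sum-first (suc n) (λ i → a i * b (suc n ∸ i)) ⟨
    sum (suc (suc n)) (λ i → a i * b (suc n ∸ i))  ∎

  conv-cong : ∀ n {a a' b b'} → (∀ i → a i ≈ a' i) → (∀ i → b i ≈ b' i) → conv a b n ≈ conv a' b' n
  conv-cong zero    p q = *-cong (p 0) (q 0)
  conv-cong (suc n) p q = +-cong (*-cong (p 0) (q (suc n))) (conv-cong n (p ∘ suc) q)

  conv-distribʳ : ∀ n c a b → conv (λ i → a i + b i) c n ≈ conv a c n + conv b c n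
  conv-distribʳ zero    c a b = distribʳ _ _ _
  conv-distribʳ (suc n) c a b = begin
    (a 0 + b 0) * c (suc n) + conv (λ i → a (suc i) + b (suc i)) c n
      ≈⟨ +-congˡ (conv-distribʳ n c (a ∘ suc) (b ∘ suc)) ⟩
    (a 0 + b 0) * c (suc n) + (conv (a ∘ suc) c n + conv (b ∘ suc) c n)
      ≈⟨ solve 5 (λ a b c p q → (a :+ b) :* c :+ (p :+ q) := a :* c :+ p :+ (b :* c :+ q)) refl
           (a 0) (b 0) (c (suc n)) (conv (a ∘ suc) c n) (conv (b ∘ suc) c n) ⟩
    a 0 * c (suc n) + conv (a ∘ suc) c n + (b 0 * c (suc n) + conv (b ∘ suc) c n)  ∎

  conv-scale : ∀ n r a b → conv (λ i → r * a i) b n ≈ r * conv a b n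
  conv-scale zero    r a b = *-assoc _ _ _
  conv-scale (suc n) r a b =
    trans (+-cong (*-assoc _ _ _) (conv-scale n r (a ∘ suc) b)) (sym (distribˡ _ _ _))

  -- The mirror image of the defining recursion, passing to the tail of the second factor;
  -- commutativity follows by playing the two against each other.
  conv-suc : ∀ n a b → conv a b (suc n) ≈ a (suc n) * b 0 + conv a (b ∘ suc) n
  conv-suc zero    a b = +-comm _ _
  conv-suc (suc n) a b = begin
    a 0 * b (suc (suc n)) + conv (a ∘ suc) b (suc n)
      ≈⟨ +-congˡ (conv-suc n (a ∘ suc) b) ⟩
    a 0 * b (suc (suc n)) + (a (suc (suc n)) * b 0 + conv (a ∘ suc) (b ∘ suc) n)
      ≈⟨ solve 3 (λ x y z → x :+ (y :+ z) := y :+ (x :+ z)) refl _ _ _ ⟩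
    a (suc (suc n)) * b 0 + (a 0 * b (suc (suc n)) + conv (a ∘ suc) (b ∘ suc) n)  ∎

  conv-comm : ∀ n a b → conv a b n ≈ conv b a n
  conv-comm zero    a b = *-comm _ _
  conv-comm (suc n) a b =
    trans (conv-suc n a b) (+-cong (*-comm _ _) (conv-comm n a (b ∘ suc)))

  conv-assoc : ∀ n a b c → conv (conv a b) c n ≈ conv a (conv b c) n
  conv-assoc zero    a b c = *-assoc _ _ _
  conv-assoc (suc n) a b c = begin
    a 0 * b 0 * c (suc n) + conv (λ i → a 0 * b (suc i) + conv (a ∘ suc) b i) c n
      ≈⟨ +-congˡ (conv-distribʳ n c (λ i → a 0 * b (suc i)) (conv (a ∘ suc) b)) ⟩
    a 0 * b 0 * c (suc n) + (conv (λ i → a 0 * b (suc i)) c n + conv (conv (a ∘ suc) b) c n)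
      ≈⟨ +-congˡ (+-cong (conv-scale n (a 0) (b ∘ suc) c) (conv-assoc n (a ∘ suc) b c)) ⟩
    a 0 * b 0 * c (suc n) + (a 0 * conv (b ∘ suc) c n + conv (a ∘ suc) (conv b c) n)
      ≈⟨ solve 5 (λ a b c p q → a :* b :* c :+ (a :* p :+ q) := a :* (b :* c :+ p) :+ q) refl
           (a 0) (b 0) (c (suc n)) (conv (b ∘ suc) c n) _ ⟩
    a 0 * (b 0 * c (suc n) + conv (b ∘ suc) c n) + conv (a ∘ suc) (conv b c) n  ∎

  ι : Carrier → Series
  ι a zero    = a
  ι a (suc n) = 0#

  conv-zeroˡ : ∀ n b → conv (λ _ → 0#) b n ≈ 0#
  conv-zeroˡ zero    b = zeroˡ _
  conv-zeroˡ (suc n) b = trans (+-cong (zeroˡ _) (conv-zeroˡ n b)) (+-identityˡ _)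

  conv-ι : ∀ n a b → conv (ι a) b n ≈ a * b n
  conv-ι zero    a b = refl
  conv-ι (suc n) a b = trans (+-congˡ (conv-zeroˡ n b)) (+-identityʳ _)

  powerSeries : CommutativeRing c ℓ
  powerSeries = record
    { Carrier = Series
    ; _≈_ = _≋_
    ; _+_ = λ a b n → a n + b n
    ; _*_ = conv
    ; -_  = λ a n → - a n
    ; 0#  = λ _ → 0#
    ; 1#  = ι 1#
    ; isCommutativeRing = record
      { isRing = record
        { +-isAbelianGroup = record
          { isGroup = record
            { isMonoid = record
              { isSemigroup = record
                { isMagma = record
                  { isEquivalence = record
                    { refl  = coeffwise λ _ → refl
                    ; sym   = λ p → coeffwise λ n → sym (coeff p n)
                    ; trans = λ p q → coeffwise λ n → trans (coeff p n) (coeff q n)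
                    }
                  ; ∙-cong = λ p q → coeffwise λ n → +-cong (coeff p n) (coeff q n)
                  }
                ; assoc = λ a b c → coeffwise λ n → +-assoc (a n) (b n) (c n)
                }
              ; identity = (λ a → coeffwise λ n → +-identityˡ (a n)) , (λ a → coeffwise λ n → +-identityʳ (a n))
              }
            ; inverse = (λ a → coeffwise λ n → -‿inverseˡ (a n)) , (λ a → coeffwise λ n → -‿inverseʳ (a n))
            ; ⁻¹-cong = λ p → coeffwise λ n → -‿cong (coeff p n)
            }
          ; comm = λ a b → coeffwise λ n → +-comm (a n) (b n)
          }
        ; *-cong = λ p q → coeffwise λ n → conv-cong n (coeff p) (coeff q)
        ; *-assoc = λ a b c → coeffwise λ n → conv-assoc n a b c
        ; *-identity =
            (λ a → coeffwise λ n → trans (conv-ι n 1# a) (*-identityˡ _)) ,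
            (λ a → coeffwise λ n → trans (conv-comm n a (ι 1#)) (trans (conv-ι n 1# a) (*-identityˡ _)))
        ; distrib =
            (λ c a b → coeffwise λ n → trans (conv-comm n c _)
               (trans (conv-distribʳ n c a b) (+-cong (conv-comm n a c) (conv-comm n b c)))) ,
            (λ c a b → coeffwise λ n → conv-distribʳ n c a b)
        }
      ; *-comm = λ a b → coeffwise λ n → conv-comm n a b
      }
    }

  module P = CommutativeRing powerSeries

  ι-cong : ∀ {a b} → a ≈ b → ι a ≋ ι b
  ι-cong a≈b = coeffwise λ { zero → a≈b ; (suc n) → refl }

  ι-* : ∀ a b → ι (a * b) ≋ ι a P.* ι b
  ι-* a b = coeffwise λ { zero → refl ; (suc n) → sym (trans (conv-ι (suc n) a (ι b)) (zeroʳ a)) }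

  ι-+ : ∀ a b → ι (a + b) ≋ ι a P.+ ι b
  ι-+ a b = coeffwise λ { zero → refl ; (suc n) → sym (+-identityˡ _) }

  ι-‿- : ∀ a → ι (- a) ≋ P.- ι a
  ι-‿- a = coeffwise λ { zero → refl ; (suc n) → sym -0#≈0# }

  ι-0 : ι 0# ≋ P.0#
  ι-0 = coeffwise λ { zero → refl ; (suc n) → refl }

  open Algebra.Properties.Semiring.Exp P.semiring public using () renaming (_^_ to _^ᵖ_)

  ι-^ : ∀ a n → ι (a ^ n) ≋ ι a ^ᵖ n
  ι-^ a zero    = P.refl
  ι-^ a (suc n) = P.trans (ι-* a (a ^ n)) (P.*-congˡ (ι-^ a n))

  var : Series
  var zero          = 0#
  var (suc zero)    = 1#
  var (suc (suc n)) = 0#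

  conv-var-zero : ∀ b → conv var b 0 ≈ 0#
  conv-var-zero b = zeroˡ _

  conv-var-suc : ∀ n b → conv var b (suc n) ≈ b n
  conv-var-suc n b = begin
    0# * b (suc n) + conv (var ∘ suc) b n  ≈⟨ +-congʳ (zeroˡ _) ⟩
    0# + conv (var ∘ suc) b n              ≈⟨ +-identityˡ _ ⟩
    conv (var ∘ suc) b n                   ≈⟨ conv-cong n (λ { zero → refl ; (suc _) → refl }) (λ _ → refl) ⟩
    conv (ι 1#) b n                        ≈⟨ conv-ι n 1# b ⟩
    1# * b n                               ≈⟨ *-identityˡ _ ⟩
    b n                                    ∎

  var-diag : ∀ n b → (var ^ᵖ n P.* b) n ≈ b 0
  var-diag zero    b = *-identityˡ _
  var-diag (suc n) b = begin
    conv (conv var (var ^ᵖ n)) b (suc n)  ≈⟨ conv-assoc (suc n) var (var ^ᵖ n) b ⟩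
    conv var (conv (var ^ᵖ n) b) (suc n)  ≈⟨ conv-var-suc n _ ⟩
    conv (var ^ᵖ n) b n                   ≈⟨ var-diag n b ⟩
    b 0                                   ∎

  var-above : ∀ {i n} → i < n → ∀ b → (var ^ᵖ i P.* ι b) n ≈ 0#
  var-above {zero}  {suc n} _ b = trans (conv-ι (suc n) 1# (ι b)) (zeroʳ _)
  var-above {suc i} {suc n} (s≤s i<n) b = begin
    conv (conv var (var ^ᵖ i)) (ι b) (suc n)  ≈⟨ conv-assoc (suc n) var (var ^ᵖ i) (ι b) ⟩
    conv var (conv (var ^ᵖ i) (ι b)) (suc n)  ≈⟨ conv-var-suc n _ ⟩
    conv (var ^ᵖ i) (ι b) n                   ≈⟨ var-above i<n b ⟩
    0#                                        ∎

  var-below : ∀ {i n} → n < i → ∀ b → (var ^ᵖ i P.* b) n ≈ 0#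
  var-below {suc i} {zero}  _ b = trans (conv-assoc zero var (var ^ᵖ i) b) (zeroˡ _)
  var-below {suc i} {suc n} (s≤s n<i) b = begin
    conv (conv var (var ^ᵖ i)) b (suc n)  ≈⟨ conv-assoc (suc n) var (var ^ᵖ i) b ⟩
    conv var (conv (var ^ᵖ i) b) (suc n)  ≈⟨ conv-var-suc n _ ⟩
    conv (var ^ᵖ i) b n                   ≈⟨ var-below n<i b ⟩
    0#                                    ∎

  -- a(u) ↦ a(tu)
  dilate : Carrier → Series → Series
  dilate t a n = t ^ n * a n

  dilate-cong : ∀ t {a b} → a ≋ b → dilate t a ≋ dilate t b
  dilate-cong t p = coeffwise λ n → *-congˡ (coeff p n)

  dilate-+ : ∀ t a b → dilate t (a P.+ b) ≋ dilate t a P.+ dilate t b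
  dilate-+ t a b = coeffwise λ n → distribˡ _ _ _

  dilate-‿- : ∀ t a → dilate t (P.- a) ≋ P.- dilate t a
  dilate-‿- t a = coeffwise λ n → solve 2 (λ s x → s :* :- x := :- (s :* x)) refl (t ^ n) (a n)

  dilate-* : ∀ t a b → dilate t (a P.* b) ≋ dilate t a P.* dilate t b
  dilate-* t a b = coeffwise λ n → go n a
    where
    go : ∀ n a → t ^ n * conv a b n ≈ conv (dilate t a) (dilate t b) n
    go zero a = solve 2 (λ a b → con 1ℤ :* (a :* b) := (con 1ℤ :* a) :* (con 1ℤ :* b)) refl (a 0) (b 0)
    go (suc n) a = begin
      t * t ^ n * (a 0 * b (suc n) + conv (a ∘ suc) b n)
        ≈⟨ solve 5 (λ t s a b r → t :* s :* (a :* b :+ r) := (con 1ℤ :* a) :* (t :* s :* b) :+ t :* (s :* r)) refl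
             t (t ^ n) (a 0) (b (suc n)) (conv (a ∘ suc) b n) ⟩
      1# * a 0 * (t * t ^ n * b (suc n)) + t * (t ^ n * conv (a ∘ suc) b n)
        ≈⟨ +-congˡ (*-congˡ (go n (a ∘ suc))) ⟩
      1# * a 0 * (t * t ^ n * b (suc n)) + t * conv (dilate t (a ∘ suc)) (dilate t b) n
        ≈⟨ +-congˡ (conv-scale n t (dilate t (a ∘ suc)) (dilate t b)) ⟨
      1# * a 0 * (t * t ^ n * b (suc n)) + conv (λ i → t * (t ^ i * a (suc i))) (dilate t b) n
        ≈⟨ +-congˡ (conv-cong n (λ i → sym (*-assoc _ _ _)) (λ _ → refl)) ⟩
      1# * a 0 * (t * t ^ n * b (suc n)) + conv (dilate t a ∘ suc) (dilate t b) n  ∎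

  dilate-ι : ∀ t a → dilate t (ι a) ≋ ι a
  dilate-ι t a = coeffwise λ { zero → *-identityˡ _ ; (suc n) → zeroʳ _ }

  dilate-var : ∀ t → dilate t var ≋ ι t P.* var
  dilate-var t = coeffwise λ
    { zero          → trans (zeroʳ _) (sym (zeroʳ _))
    ; (suc zero)    → trans (*-congʳ (*-identityʳ t)) (sym (conv-ι 1 t var))
    ; (suc (suc n)) → trans (zeroʳ _) (sym (trans (conv-ι (suc (suc n)) t var) (zeroʳ t))) }

-- The ring of Laurent polynomials, and cancellation of 1 - x⁻¹y in it.

+E-assoc : ∀ m m' m'' → (m +E m') +E m'' ≡ m +E (m' +E m'')
+E-assoc (a , b , c , d) (a' , b' , c' , d') (a'' , b'' , c'' , d'')
  rewrite ℤₚ.+-assoc a a' a'' | ℤₚ.+-assoc b b' b'' | ℤₚ.+-assoc c c' c'' | ℤₚ.+-assoc d d' d'' = ≡.refl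

+E-comm : ∀ m m' → m +E m' ≡ m' +E m
+E-comm (a , b , c , d) (a' , b' , c' , d')
  rewrite ℤₚ.+-comm a a' | ℤₚ.+-comm b b' | ℤₚ.+-comm c c' | ℤₚ.+-comm d d' = ≡.refl

+E-identityˡ : ∀ m → 0E +E m ≡ m
+E-identityˡ (a , b , c , d)
  rewrite ℤₚ.+-identityˡ a | ℤₚ.+-identityˡ b | ℤₚ.+-identityˡ c | ℤₚ.+-identityˡ d = ≡.refl

module Laurent {c ℓ : Level} (K : CommutativeRing c ℓ) (β : CommutativeRing.Carrier K) where
  open import Data.Integer using (+_; -[1+_])
  open CommutativeRing K hiding (zero)
  open Cyc K β
  open RingSolver K
  open Algebra.Properties.Ring ring
  open SetoidReasoning setoid

  -- A Laurent polynomial as a linear functional on functions of exponents. Products become iterated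
  -- pairings, so the ring laws reduce to exchanging two sums and to the laws of `_+E_`.
  pair : Lau → (Exp → Carrier) → Carrier
  pair []            f = 0#
  pair ((a , m) ∷ p) f = a * f m + pair p f

  indicator : Exp → Exp → Carrier
  indicator m m' = if does (m' ≟E m) then 1# else 0#

  indicator-≢ : ∀ {m m'} → ¬ m' ≡ m → indicator m m' ≡ 0#
  indicator-≢ {m} {m'} m'≢m = ≡.cong (if_then 1# else 0#) (dec-false (m' ≟E m) m'≢m)

  coeffL-pair : ∀ p m → coeffL p m ≈ pair p (indicator m)
  coeffL-pair []             m = refl
  coeffL-pair ((a , m') ∷ p) m =
    trans (add-if (does (m' ≟E m)) (coeffL p m)) (+-congˡ (coeffL-pair p m))
    where
    add-if : ∀ b r → (if b then a + r else r) ≈ a * (if b then 1# else 0#) + r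
    add-if true  r = +-congʳ (sym (*-identityʳ a))
    add-if false r = sym (trans (+-congʳ (zeroʳ a)) (+-identityˡ r))

  pair-cong : ∀ p {f g} → (∀ m → f m ≈ g m) → pair p f ≈ pair p g
  pair-cong []            f≈g = refl
  pair-cong ((a , m) ∷ p) f≈g = +-cong (*-congˡ (f≈g m)) (pair-cong p f≈g)

  pair-++ : ∀ p p' f → pair (p ++ p') f ≈ pair p f + pair p' f
  pair-++ []            p' f = sym (+-identityˡ _)
  pair-++ ((a , m) ∷ p) p' f = trans (+-congˡ (pair-++ p p' f)) (sym (+-assoc _ _ _))

  pair-neg : ∀ p f → pair (-L p) f ≈ - pair p f
  pair-neg []            f = sym -0#≈0#
  pair-neg ((a , m) ∷ p) f = trans (+-congˡ (pair-neg p f))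
    (solve 3 (λ a x r → (:- a) :* x :+ (:- r) := :- (a :* x :+ r)) refl a (f m) (pair p f))

  pair-zero : ∀ p → pair p (λ _ → 0#) ≈ 0#
  pair-zero []            = refl
  pair-zero ((a , m) ∷ p) = trans (+-cong (zeroʳ a) (pair-zero p)) (+-identityˡ _)

  pair-linear : ∀ p b f g → pair p (λ m → b * f m + g m) ≈ b * pair p f + pair p g
  pair-linear []            b f g = sym (trans (+-identityʳ _) (zeroʳ b))
  pair-linear ((a , m) ∷ p) b f g = trans (+-congˡ (pair-linear p b f g))
    (solve 6 (λ a b x y s t → a :* (b :* x :+ y) :+ (b :* s :+ t) := b :* (a :* x :+ s) :+ (a :* y :+ t))
       refl a b (f m) (g m) (pair p f) (pair p g))

  pair-swap : ∀ p p' (F : Exp → Exp → Carrier) → pair p (λ m → pair p' (F m)) ≈ pair p' (λ m' → pair p (λ m → F m m'))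
  pair-swap []            p' F = sym (pair-zero p')
  pair-swap ((a , m) ∷ p) p' F =
    trans (+-congˡ (pair-swap p p' F)) (sym (pair-linear p' a (F m) (λ m' → pair p (λ m → F m m'))))

  pair-shift : ∀ {h : Carrier × Exp → Carrier × Exp} a m → (∀ b m' → h (b , m') ≡ (a * b , m +E m')) →
    ∀ p f → pair (map h p) f ≈ a * pair p (λ m' → f (m +E m'))
  pair-shift a m h≡ []             f = sym (zeroʳ a)
  pair-shift {h} a m h≡ ((b , m') ∷ p) f = begin
    pair (h (b , m') ∷ map h p) f
      ≡⟨ ≡.cong (λ t → pair (t ∷ map h p) f) (h≡ b m') ⟩
    a * b * f (m +E m') + pair (map h p) f
      ≈⟨ +-congˡ (pair-shift a m h≡ p f) ⟩
    a * b * f (m +E m') + a * pair p (λ m' → f (m +E m'))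
      ≈⟨ solve 4 (λ a b x r → a :* b :* x :+ a :* r := a :* (b :* x :+ r)) refl
           a b (f (m +E m')) (pair p (λ m' → f (m +E m'))) ⟩
    a * (b * f (m +E m') + pair p (λ m' → f (m +E m')))  ∎

  pair-*L : ∀ p p' f → pair (p *L p') f ≈ pair p (λ m → pair p' (λ m' → f (m +E m')))
  pair-*L []            p' f = refl
  pair-*L ((a , m) ∷ p) p' f =
    trans (pair-++ (map _ p') (p *L p') f) (+-cong (pair-shift a m (λ _ _ → ≡.refl) p' f) (pair-*L p p' f))

  remove : Exp → Lau → Lau
  remove k []            = []
  remove k ((a , m) ∷ p) = if does (m ≟E k) then remove k p else (a , m) ∷ remove k p

  remove-length : ∀ k p → length (remove k p) ≤ length p
  remove-length k []            = z≤n
  remove-length k ((a , m) ∷ p) with does (m ≟E k)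
  ... | true  = ℕₚ.m≤n⇒m≤1+n (remove-length k p)
  ... | false = s≤s (remove-length k p)

  -- Gathers the repeated occurrences of the exponent k into a single term, whose coefficient is the
  -- total one.
  pair-remove : ∀ k p f → pair p f ≈ f k * pair p (indicator k) + pair (remove k p) f
  pair-remove k []            f = sym (trans (+-identityʳ _) (zeroʳ _))
  pair-remove k ((a , m) ∷ p) f = trans (+-congˡ (pair-remove k p f)) (split (m ≟E k))
    where
    s = pair p (indicator k)
    r = pair (remove k p) f
    split : (m≟k : Dec (m ≡ k)) →
      a * f m + (f k * s + r) ≈
      f k * (a * (if does m≟k then 1# else 0#) + s) + pair (if does m≟k then remove k p else (a , m) ∷ remove k p) f
    split (yes ≡.refl) = solve 4 (λ a x s r → a :* x :+ (x :* s :+ r) := x :* (a :* con 1ℤ :+ s) :+ r) refl a (f k) s r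
    split (no _) = solve 5 (λ a x y s r → a :* x :+ (y :* s :+ r) := y :* (a :* con 0ℤ :+ s) :+ (a :* x :+ r)) refl
      a (f m) (f k) s r

  pair-null : ∀ n p → length p ≤ n → (∀ m → pair p (indicator m) ≈ 0#) → ∀ f → pair p f ≈ 0#
  pair-null n []              _         null f = refl
  pair-null (suc n) ((a , k) ∷ p) (s≤s len) null f = begin
    pair p⁺ f                                         ≈⟨ pair-remove k p⁺ f ⟩
    f k * pair p⁺ (indicator k) + pair (remove k p⁺) f  ≈⟨ +-congʳ (trans (*-congˡ (null k)) (zeroʳ _)) ⟩
    0# + pair (remove k p⁺) f                         ≈⟨ +-identityˡ _ ⟩
    pair (remove k p⁺) f                              ≡⟨ ≡.cong (λ l → pair l f) remove≡ ⟩
    pair (remove k p) f                               ≈⟨ pair-null n (remove k p) (ℕₚ.≤-trans (remove-length k p) len) null' f ⟩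
    0#                                                ∎
    where
    p⁺ = (a , k) ∷ p
    remove≡ : remove k p⁺ ≡ remove k p
    remove≡ = ≡.cong (if_then remove k p else (a , k) ∷ remove k p) (dec-true (k ≟E k) ≡.refl)
    null' : ∀ m → pair (remove k p) (indicator m) ≈ 0#
    null' m = begin
      pair (remove k p) (indicator m)    ≡⟨ ≡.cong (λ l → pair l (indicator m)) remove≡ ⟨
      pair (remove k p⁺) (indicator m)   ≈⟨ +-identityˡ _ ⟨
      0# + pair (remove k p⁺) (indicator m)
        ≈⟨ +-congʳ (trans (*-congˡ (null k)) (zeroʳ _)) ⟨
      indicator m k * pair p⁺ (indicator k) + pair (remove k p⁺) (indicator m)
        ≈⟨ pair-remove k p⁺ (indicator m) ⟨
      pair p⁺ (indicator m)              ≈⟨ null m ⟩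
      0#                                 ∎

  infix 4 _≈ᴸ_
  -- Testing against every f, not only against indicators, makes this a congruence for the product
  -- at once; `indicator-ext` shows that indicators suffice.
  record _≈ᴸ_ (p p' : Lau) : Set (c ⊔ ℓ) where
    constructor paired
    field pairing : ∀ f → pair p f ≈ pair p' f
  open _≈ᴸ_ public

  -- A Laurent polynomial is determined by its coefficients, although the
  -- list representing it may repeat exponents.
  indicator-ext : ∀ {p p'} → (∀ m → pair p (indicator m) ≈ pair p' (indicator m)) → p ≈ᴸ p'
  indicator-ext {p} {p'} p≈p' = paired λ f → begin
    pair p f                            ≈⟨ solve 2 (λ x y → x := x :- y :+ y) refl (pair p f) (pair p' f) ⟩
    pair p f - pair p' f + pair p' f    ≈⟨ +-congʳ (trans (sym (diff f)) (pair-null _ (p +L (-L p')) ℕₚ.≤-refl null f)) ⟩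
    0# + pair p' f                      ≈⟨ +-identityˡ _ ⟩
    pair p' f                           ∎
    where
    diff : ∀ f → pair (p +L (-L p')) f ≈ pair p f - pair p' f
    diff f = trans (pair-++ p (-L p') f) (+-congˡ (pair-neg p' f))
    null : ∀ m → pair (p +L (-L p')) (indicator m) ≈ 0#
    null m = trans (diff (indicator m)) (trans (+-congʳ (p≈p' m)) (-‿inverseʳ _))

  ≈ᴸ⇒≈L : ∀ {p p'} → p ≈ᴸ p' → p ≈L p'
  ≈ᴸ⇒≈L {p} {p'} p≈p' m =
    trans (coeffL-pair p m) (trans (pairing p≈p' (indicator m)) (sym (coeffL-pair p' m)))

  *L-cong : ∀ {p p' r r'} → p ≈ᴸ p' → r ≈ᴸ r' → p *L r ≈ᴸ p' *L r'
  *L-cong {p} {p'} {r} {r'} p≈p' r≈r' = paired λ f → begin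
    pair (p *L r) f                                ≈⟨ pair-*L p r f ⟩
    pair p (λ m → pair r (λ m' → f (m +E m')))     ≈⟨ pair-cong p (λ m → pairing r≈r' _) ⟩
    pair p (λ m → pair r' (λ m' → f (m +E m')))    ≈⟨ pairing p≈p' _ ⟩
    pair p' (λ m → pair r' (λ m' → f (m +E m')))   ≈⟨ pair-*L p' r' f ⟨
    pair (p' *L r') f                              ∎

  *L-comm : ∀ p p' → p *L p' ≈ᴸ p' *L p
  *L-comm p p' = paired λ f → begin
    pair (p *L p') f                               ≈⟨ pair-*L p p' f ⟩
    pair p (λ m → pair p' (λ m' → f (m +E m')))    ≈⟨ pair-swap p p' (λ m m' → f (m +E m')) ⟩
    pair p' (λ m' → pair p (λ m → f (m +E m')))
      ≈⟨ pair-cong p' (λ m' → pair-cong p (λ m → reflexive (≡.cong f (+E-comm m m')))) ⟩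
    pair p' (λ m' → pair p (λ m → f (m' +E m)))    ≈⟨ pair-*L p' p f ⟨
    pair (p' *L p) f                               ∎

  *L-assoc : ∀ p p' p'' → (p *L p') *L p'' ≈ᴸ p *L (p' *L p'')
  *L-assoc p p' p'' = paired λ f → begin
    pair ((p *L p') *L p'') f                                           ≈⟨ pair-*L (p *L p') p'' f ⟩
    pair (p *L p') (λ m → pair p'' (λ m'' → f (m +E m'')))             ≈⟨ pair-*L p p' _ ⟩
    pair p (λ m → pair p' (λ m' → pair p'' (λ m'' → f ((m +E m') +E m''))))
      ≈⟨ pair-cong p (λ m → pair-cong p' λ m' → pair-cong p'' λ m'' → reflexive (≡.cong f (+E-assoc m m' m''))) ⟩
    pair p (λ m → pair p' (λ m' → pair p'' (λ m'' → f (m +E (m' +E m'')))))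
      ≈⟨ pair-cong p (λ m → pair-*L p' p'' (λ m' → f (m +E m'))) ⟨
    pair p (λ m → pair (p' *L p'') (λ m' → f (m +E m')))               ≈⟨ pair-*L p (p' *L p'') f ⟨
    pair (p *L (p' *L p'')) f                                          ∎

  monoL-*L : ∀ a m p f → pair (monoL a m *L p) f ≈ a * pair p (λ m' → f (m +E m'))
  monoL-*L a m p f = trans (pair-*L (monoL a m) p f) (+-identityʳ _)

  *L-identityˡ : ∀ p → 1L *L p ≈ᴸ p
  *L-identityˡ p = paired λ f → trans (monoL-*L 1# 0E p f)
    (trans (*-identityˡ _) (pair-cong p λ m → reflexive (≡.cong f (+E-identityˡ m))))

  *L-distribʳ : ∀ r p p' → (p +L p') *L r ≈ᴸ (p *L r) +L (p' *L r)
  *L-distribʳ r p p' = paired λ f → begin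
    pair ((p +L p') *L r) f                  ≈⟨ pair-*L (p +L p') r f ⟩
    pair (p +L p') _                         ≈⟨ pair-++ p p' _ ⟩
    pair p _ + pair p' _                     ≈⟨ +-cong (pair-*L p r f) (pair-*L p' r f) ⟨
    pair (p *L r) f + pair (p' *L r) f       ≈⟨ pair-++ (p *L r) (p' *L r) f ⟨
    pair ((p *L r) +L (p' *L r)) f           ∎

  +L-cong : ∀ {p p' r r'} → p ≈ᴸ p' → r ≈ᴸ r' → p +L r ≈ᴸ p' +L r'
  +L-cong {p} {p'} {r} {r'} p≈p' r≈r' = paired λ f →
    trans (pair-++ p r f) (trans (+-cong (pairing p≈p' f) (pairing r≈r' f)) (sym (pair-++ p' r' f)))

  +L-comm : ∀ p p' → p +L p' ≈ᴸ p' +L p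
  +L-comm p p' = paired λ f → trans (pair-++ p p' f) (trans (+-comm _ _) (sym (pair-++ p' p f)))

  -L-inverseʳ : ∀ p → p +L (-L p) ≈ᴸ []
  -L-inverseʳ p = paired λ f →
    trans (pair-++ p (-L p) f) (trans (+-congˡ (pair-neg p f)) (-‿inverseʳ _))

  ≈ᴸ-refl : ∀ {p} → p ≈ᴸ p
  ≈ᴸ-refl = paired λ _ → refl

  ≈ᴸ-trans : ∀ {p p' p''} → p ≈ᴸ p' → p' ≈ᴸ p'' → p ≈ᴸ p''
  ≈ᴸ-trans e e' = paired λ f → trans (pairing e f) (pairing e' f)

  laurentRing : CommutativeRing c (c ⊔ ℓ)
  laurentRing = record
    { Carrier = Lau
    ; _≈_ = _≈ᴸ_
    ; _+_ = _+L_
    ; _*_ = _*L_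
    ; -_  = -L_
    ; 0#  = []
    ; 1#  = 1L
    ; isCommutativeRing = record
      { isRing = record
        { +-isAbelianGroup = record
          { isGroup = record
            { isMonoid = record
              { isSemigroup = record
                { isMagma = record
                  { isEquivalence = record
                    { refl  = ≈ᴸ-refl
                    ; sym   = λ e → paired λ f → sym (pairing e f)
                    ; trans = ≈ᴸ-trans
                    }
                  ; ∙-cong = +L-cong
                  }
                ; assoc = λ p p' p'' → paired λ f → reflexive (≡.cong (λ l → pair l f) (++-assoc p p' p''))
                }
              ; identity = (λ p → ≈ᴸ-refl) , (λ p → +L-comm p [])
              }
            ; inverse = (λ p → ≈ᴸ-trans (+L-comm (-L p) p) (-L-inverseʳ p)) , -L-inverseʳ
            ; ⁻¹-cong = λ {p} {p'} e → paired λ f →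
                trans (pair-neg p f) (trans (-‿cong (pairing e f)) (sym (pair-neg p' f)))
            }
          ; comm = +L-comm
          }
        ; *-cong = *L-cong
        ; *-assoc = *L-assoc
        ; *-identity = *L-identityˡ , (λ p → ≈ᴸ-trans (*L-comm p 1L) (*L-identityˡ p))
        ; distrib =
            (λ r p p' → ≈ᴸ-trans (*L-comm r _)
               (≈ᴸ-trans (*L-distribʳ r p p') (+L-cong (*L-comm p r) (*L-comm p' r)))) ,
            *L-distribʳ
        }
      ; *-comm = *L-comm
      }
    }

  -- The indicator of the half-line m, m + (1,-1,0,0), m + (2,-2,0,0), …;
  -- multiplication by 1 − x⁻¹y turns it into the indicator of m, which is
  -- why that factor can be cancelled.
  halfLine′ : Exp → ℤ → ℤ → ℤ → ℤ → Carrier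
  halfLine′ m@(a , _) (+ t)    b' c' d' = indicator m (a , b' ℤ.+ + t , c' , d')
  halfLine′ m         -[1+ _ ] b' c' d' = 0#

  halfLine : Exp → Exp → Carrier
  halfLine m@(a , _) (a' , b' , c' , d') = halfLine′ m (a' ℤ.- a) b' c' d'

  halfLine-diff : ∀ m m' →
    halfLine m m' - halfLine m (m' +E (-1ℤ , 1ℤ , 0ℤ , 0ℤ)) ≈ indicator m m'
  halfLine-diff m@(a , b , c , d) m'@(a' , b' , c' , d')
    rewrite ℤₚ.+-identityʳ c' | ℤₚ.+-identityʳ d' =
    trans (+-congˡ (-‿cong (reflexive (≡.cong (λ s → halfLine′ m s (b' ℤ.+ 1ℤ) c' d') shift)))) (go (a' ℤ.- a) ≡.refl)
    where
    shift : (a' ℤ.+ -1ℤ) ℤ.- a ≡ (a' ℤ.- a) ℤ.+ -1ℤ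
    shift = ≡.trans (ℤₚ.+-assoc a' -1ℤ (ℤ.- a))
              (≡.trans (≡.cong (λ i → a' ℤ.+ i) (ℤₚ.+-comm -1ℤ (ℤ.- a))) (≡.sym (ℤₚ.+-assoc a' (ℤ.- a) -1ℤ)))
    off : ∀ {s} → a' ℤ.- a ≡ s → ¬ s ≡ 0ℤ → ¬ m' ≡ m
    off a'-a≡s s≢0 ≡.refl = s≢0 (≡.trans (≡.sym a'-a≡s) (ℤₚ.+-inverseʳ a))
    go : ∀ s → a' ℤ.- a ≡ s →
      halfLine′ m s b' c' d' - halfLine′ m (s ℤ.+ -1ℤ) (b' ℤ.+ 1ℤ) c' d' ≈ indicator m m'
    -- The endpoint: the shifted exponent has left the half-line, and the indicator remains. Beyond
    -- it the two terms cancel, and before it both vanish.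
    go (+ zero) a'-a≡s
      rewrite ℤₚ.+-identityʳ b' | ℤₚ.i-j≡0⇒i≡j a' a a'-a≡s = trans (+-congˡ -0#≈0#) (+-identityʳ _)
    go (+ suc t) a'-a≡s = begin
      indicator m (a , b' ℤ.+ + suc t , c' , d') - indicator m (a , (b' ℤ.+ 1ℤ) ℤ.+ + t , c' , d')
        ≡⟨ ≡.cong (λ r → indicator m (a , b' ℤ.+ + suc t , c' , d') - indicator m (a , r , c' , d'))
             (ℤₚ.+-assoc b' 1ℤ (+ t)) ⟩
      indicator m (a , b' ℤ.+ + suc t , c' , d') - indicator m (a , b' ℤ.+ + suc t , c' , d')
        ≈⟨ -‿inverseʳ _ ⟩
      0#
        ≡⟨ indicator-≢ (off a'-a≡s λ ()) ⟨
      indicator m m'  ∎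
    go -[1+ n ] a'-a≡s = trans (-‿inverseʳ 0#) (reflexive (≡.sym (indicator-≢ (off a'-a≡s λ ()))))

  -- Multiplication by 1 - x⁻¹y transposes to the difference f(m') - f(m' + (-1,1,0,0)), and
  -- `halfLine m` is a discrete antiderivative of the indicator. So each coefficient of p can be
  -- read off p times 1 - x⁻¹y.
  pair-dL : ∀ m p → pair (p *L dL) (halfLine m) ≈ pair p (indicator m)
  pair-dL m p = begin
    pair (p *L dL) (halfLine m)
      ≈⟨ pair-*L p dL (halfLine m) ⟩
    pair p (λ m' → 1# * halfLine m (m' +E 0E) + (- 1# * halfLine m (m' +E (-1ℤ , 1ℤ , 0ℤ , 0ℤ)) + 0#))
      ≈⟨ pair-cong p (λ m' → +-congʳ (*-congˡ (reflexive (≡.cong (halfLine m) (≡.trans (+E-comm m' 0E) (+E-identityˡ m')))))) ⟩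
    pair p (λ m' → 1# * halfLine m m' + (- 1# * halfLine m (m' +E (-1ℤ , 1ℤ , 0ℤ , 0ℤ)) + 0#))
      ≈⟨ pair-cong p (λ m' → trans
           (solve 2 (λ x y → con 1ℤ :* x :+ (:- con 1ℤ :* y :+ con 0ℤ) := x :- y) refl _ _) (halfLine-diff m m')) ⟩
    pair p (indicator m)  ∎

  *dL-cancelʳ : ∀ p p' → p *L dL ≈ᴸ p' *L dL → p ≈ᴸ p'
  *dL-cancelʳ p p' e = indicator-ext λ m →
    trans (sym (pair-dL m p)) (trans (pairing e (halfLine m)) (pair-dL m p'))

-- The ring of fractions with powers of 1 - x⁻¹y as denominators.

module CrossMultiplication {c ℓ : Level} (R : CommutativeRing c ℓ) where
  open CommutativeRing R
  open RingSolver R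
  open SetoidReasoning setoid

  -- The two equations combine to the claim multiplied by the middle denominator s', hence the need
  -- to cancel it.
  cross-trans : ∀ {p s p' s' p'' s''} → (∀ a b → a * s' ≈ b * s' → a ≈ b) →
    p * s' ≈ p' * s → p' * s'' ≈ p'' * s' → p * s'' ≈ p'' * s
  cross-trans {p} {s} {p'} {s'} {p''} {s''} cancel e e' = cancel _ _ (begin
    (p * s'') * s'  ≈⟨ swap p s'' s' ⟩
    (p * s') * s''  ≈⟨ *-congʳ e ⟩
    (p' * s) * s''  ≈⟨ swap p' s s'' ⟩
    (p' * s'') * s  ≈⟨ *-congʳ e' ⟩
    (p'' * s') * s  ≈⟨ swap p'' s' s ⟩
    (p'' * s) * s'  ∎)
    where
    swap : ∀ x y z → (x * y) * z ≈ (x * z) * y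
    swap = solve 3 (λ x y z → (x :* y) :* z := (x :* z) :* y) refl

  cross-+ : ∀ {p s p' s' q t q' t'} → p * t ≈ q * s → p' * t' ≈ q' * s' →
    (p * s' + p' * s) * (t * t') ≈ (q * t' + q' * t) * (s * s')
  cross-+ {p} {s} {p'} {s'} {q} {t} {q'} {t'} e e' = begin
    (p * s' + p' * s) * (t * t')
      ≈⟨ expand p s p' s' t t' ⟩
    (p * t) * (s' * t') + (p' * t') * (s * t)
      ≈⟨ +-cong (*-congʳ e) (*-congʳ e') ⟩
    (q * s) * (s' * t') + (q' * s') * (s * t)
      ≈⟨ collect q t q' t' s s' ⟩
    (q * t' + q' * t) * (s * s')  ∎
    where
    expand : ∀ p s p' s' t t' → (p * s' + p' * s) * (t * t') ≈ (p * t) * (s' * t') + (p' * t') * (s * t)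
    expand = solve 6 (λ p s p' s' t t' →
      (p :* s' :+ p' :* s) :* (t :* t') := (p :* t) :* (s' :* t') :+ (p' :* t') :* (s :* t)) refl
    collect : ∀ q t q' t' s s' → (q * s) * (s' * t') + (q' * s') * (s * t) ≈ (q * t' + q' * t) * (s * s')
    collect = solve 6 (λ q t q' t' s s' →
      (q :* s) :* (s' :* t') :+ (q' :* s') :* (s :* t) := (q :* t' :+ q' :* t) :* (s :* s')) refl

  cross-* : ∀ {p s p' s' q t q' t'} → p * t ≈ q * s → p' * t' ≈ q' * s' →
    (p * p') * (t * t') ≈ (q * q') * (s * s')
  cross-* {p} {s} {p'} {s'} {q} {t} {q'} {t'} e e' =
    trans (interchange p p' t t') (trans (*-cong e e') (interchange q s q' s'))
    where
    interchange : ∀ w x y z → (w * x) * (y * z) ≈ (w * y) * (x * z)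
    interchange = solve 4 (λ w x y z → (w :* x) :* (y :* z) := (w :* y) :* (x :* z)) refl

  cross-neg : ∀ {p s q t} → p * t ≈ q * s → - p * t ≈ - q * s
  cross-neg {p} {s} {q} {t} e = trans (pull p t) (trans (-‿cong e) (sym (pull q s)))
    where
    pull : ∀ x y → - x * y ≈ - (x * y)
    pull = solve 2 (λ x y → (:- x) :* y := :- (x :* y)) refl

  cross-distribʳ : ∀ r t p s p' s' →
    ((p * s' + p' * s) * r) * ((s * t) * (s' * t)) ≈ ((p * r) * (s' * t) + (p' * r) * (s * t)) * ((s * s') * t)
  cross-distribʳ = solve 6 (λ r t p s p' s' →
    ((p :* s' :+ p' :* s) :* r) :* ((s :* t) :* (s' :* t)) :=
    ((p :* r) :* (s' :* t) :+ (p' :* r) :* (s :* t)) :* ((s :* s') :* t)) refl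

  +-num-assoc : ∀ p s p' s' p'' s'' →
    (p * s' + p' * s) * s'' + p'' * (s * s') ≈ p * (s' * s'') + (p' * s'' + p'' * s') * s
  +-num-assoc = solve 6 (λ p s p' s' p'' s'' →
    (p :* s' :+ p' :* s) :* s'' :+ p'' :* (s :* s') := p :* (s' :* s'') :+ (p' :* s'' :+ p'' :* s') :* s) refl

  cross-one : ∀ m → (1# * (1# * 1# + m * 1#)) * 1# ≈ 1# * ((1# + m) * 1#)
  cross-one = solve 1 (λ m →
    (con 1ℤ :* (con 1ℤ :* con 1ℤ :+ m :* con 1ℤ)) :* con 1ℤ := con 1ℤ :* ((con 1ℤ :+ m) :* con 1ℤ)) refl

  +-num-inverseʳ : ∀ p s → p * s + - p * s ≈ 0#
  +-num-inverseʳ p s = trans (sym (distribʳ s p (- p))) (trans (*-congʳ (-‿inverseʳ p)) (zeroˡ s))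

module Fractions {c ℓ : Level} (K : CommutativeRing c ℓ) (β : CommutativeRing.Carrier K) where
  open Cyc K β
  open Laurent K β using (laurentRing; _≈ᴸ_; *dL-cancelʳ; ≈ᴸ⇒≈L)
  open CommutativeRing laurentRing hiding (zero)
  open CrossMultiplication laurentRing

  powL-+ : ∀ k k' → powL dL (k ℕ.+ k') ≈ powL dL k * powL dL k'
  powL-+ zero    k' = sym (*-identityˡ (powL dL k'))
  powL-+ (suc k) k' = trans (*-congˡ {dL} (powL-+ k k')) (sym (*-assoc dL (powL dL k) (powL dL k')))

  powL-cancelʳ : ∀ k p p' → p * powL dL k ≈ p' * powL dL k → p ≈ p'
  powL-cancelʳ zero    p p' e = trans (sym (*-identityʳ p)) (trans e (*-identityʳ p'))
  powL-cancelʳ (suc k) p p' e = *dL-cancelʳ p p' (powL-cancelʳ k _ _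
    (trans (*-assoc p dL (powL dL k)) (trans e (sym (*-assoc p' dL (powL dL k))))))

  infix 4 _≈ᶠ_
  record _≈ᶠ_ (x y : Frac) : Set (c ⊔ ℓ) where
    constructor crossed
    field cross : Frac.num x * powL dL (Frac.den y) ≈ Frac.num y * powL dL (Frac.den x)
  open _≈ᶠ_ public

  ≈ᶠ⇒≈C : ∀ {x y} → x ≈ᶠ y → x ≈C y
  ≈ᶠ⇒≈C (crossed e) = ≈ᴸ⇒≈L e

  num-cong : ∀ {p p' k k'} → p ≈ p' → k ≡ k' → p /d^ k ≈ᶠ p' /d^ k'
  num-cong e ≡.refl = crossed (*-congʳ e)

  ≡⇒≈ᶠ : ∀ {x y} → x ≡ y → x ≈ᶠ y
  ≡⇒≈ᶠ ≡.refl = crossed refl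

  ≈ᶠ-trans : ∀ {x y z} → x ≈ᶠ y → y ≈ᶠ z → x ≈ᶠ z
  ≈ᶠ-trans {p /d^ k} {p' /d^ k'} {p'' /d^ k''} (crossed e) (crossed e') =
    crossed (cross-trans {p} {powL dL k} {p'} {powL dL k'} {p''} {powL dL k''} (powL-cancelʳ k') e e')

  +C-cong : ∀ {x x' y y'} → x ≈ᶠ x' → y ≈ᶠ y' → x +C y ≈ᶠ x' +C y'
  +C-cong {p /d^ k} {q /d^ l} {p' /d^ k'} {q' /d^ l'} (crossed e) (crossed e') = crossed
    (trans (*-congˡ {(p * powL dL k') + (p' * powL dL k)} (powL-+ l l'))
      (trans (cross-+ {p} {powL dL k} {p'} {powL dL k'} {q} {powL dL l} {q'} {powL dL l'} e e')
        (*-congˡ {(q * powL dL l') + (q' * powL dL l)} (sym (powL-+ k k')))))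

  *C-cong : ∀ {x x' y y'} → x ≈ᶠ x' → y ≈ᶠ y' → x *C y ≈ᶠ x' *C y'
  *C-cong {p /d^ k} {q /d^ l} {p' /d^ k'} {q' /d^ l'} (crossed e) (crossed e') = crossed
    (trans (*-congˡ {p * p'} (powL-+ l l'))
      (trans (cross-* {p} {powL dL k} {p'} {powL dL k'} {q} {powL dL l} {q'} {powL dL l'} e e')
        (*-congˡ {q * q'} (sym (powL-+ k k')))))

  +C-assoc : ∀ x y z → (x +C y) +C z ≈ᶠ x +C (y +C z)
  +C-assoc (p /d^ k) (p' /d^ k') (p'' /d^ k'') = num-cong
    (trans (+-congˡ {(p * powL dL k' + p' * powL dL k) * powL dL k''} (*-congˡ {p''} (powL-+ k k')))
      (trans (+-num-assoc p (powL dL k) p' (powL dL k') p'' (powL dL k''))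
        (+-congʳ {(p' * powL dL k'' + p'' * powL dL k') * powL dL k} (*-congˡ {p} (sym (powL-+ k' k''))))))
    (ℕₚ.+-assoc k k' k'')

  +C-comm : ∀ x y → x +C y ≈ᶠ y +C x
  +C-comm (p /d^ k) (p' /d^ k') = num-cong (+-comm (p * powL dL k') (p' * powL dL k)) (ℕₚ.+-comm k k')

  +C-identityˡ : ∀ x → 0C +C x ≈ᶠ x
  +C-identityˡ (p /d^ k) = num-cong (*-identityʳ p) ≡.refl

  -C-inverseʳ : ∀ x → x +C (-C x) ≈ᶠ 0C
  -C-inverseʳ (p /d^ k) = crossed (trans (*-identityʳ _) (+-num-inverseʳ p (powL dL k)))

  *C-assoc : ∀ x y z → (x *C y) *C z ≈ᶠ x *C (y *C z)
  *C-assoc (p /d^ k) (p' /d^ k') (p'' /d^ k'') = num-cong (*-assoc p p' p'') (ℕₚ.+-assoc k k' k'')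

  *C-comm : ∀ x y → x *C y ≈ᶠ y *C x
  *C-comm (p /d^ k) (p' /d^ k') = num-cong (*-comm p p') (ℕₚ.+-comm k k')

  *C-identityˡ : ∀ x → 1C *C x ≈ᶠ x
  *C-identityˡ (p /d^ k) = num-cong (*-identityˡ p) ≡.refl

  -- The denominators differ: the right-hand side carries the denominator of z twice. So comparing
  -- numerators is not enough, and the equation is cross-multiplied.
  *C-distribʳ : ∀ z x y → (x +C y) *C z ≈ᶠ (x *C z) +C (y *C z)
  *C-distribʳ (r /d^ m) (p /d^ k) (p' /d^ k') = crossed (begin
    (n * r) * powL dL ((k ℕ.+ m) ℕ.+ (k' ℕ.+ m))
      ≈⟨ *-congˡ {n * r} (trans (powL-+ (k ℕ.+ m) (k' ℕ.+ m)) (*-cong (powL-+ k m) (powL-+ k' m))) ⟩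
    (n * r) * ((s * t) * (s' * t))
      ≈⟨ cross-distribʳ r t p s p' s' ⟩
    ((p * r) * (s' * t) + (p' * r) * (s * t)) * ((s * s') * t)
      ≈⟨ *-cong (+-cong (*-congˡ {p * r} (powL-+ k' m)) (*-congˡ {p' * r} (powL-+ k m)))
           (trans (powL-+ (k ℕ.+ k') m) (*-congʳ {t} (powL-+ k k'))) ⟨
    ((p * r) * powL dL (k' ℕ.+ m) + (p' * r) * powL dL (k ℕ.+ m)) * powL dL ((k ℕ.+ k') ℕ.+ m)  ∎)
    where
    open SetoidReasoning setoid
    s = powL dL k
    s' = powL dL k'
    t = powL dL m
    n = p * s' + p' * s

  fractionRing : CommutativeRing c (c ⊔ ℓ)
  fractionRing = record
    { Carrier = Frac
    ; _≈_ = _≈ᶠ_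
    ; _+_ = _+C_
    ; _*_ = _*C_
    ; -_  = -C_
    ; 0#  = 0C
    ; 1#  = 1C
    ; isCommutativeRing = record
      { isRing = record
        { +-isAbelianGroup = record
          { isGroup = record
            { isMonoid = record
              { isSemigroup = record
                { isMagma = record
                  { isEquivalence = record
                    { refl  = crossed refl
                    ; sym   = λ e → crossed (sym (cross e))
                    ; trans = ≈ᶠ-trans
                    }
                  ; ∙-cong = +C-cong
                  }
                ; assoc = +C-assoc
                }
              ; identity = +C-identityˡ , (λ x → ≈ᶠ-trans (+C-comm x 0C) (+C-identityˡ x))
              }
            ; inverse = (λ x → ≈ᶠ-trans (+C-comm (-C x) x) (-C-inverseʳ x)) , -C-inverseʳ
            ; ⁻¹-cong = λ { {p /d^ k} {q /d^ l} e → crossed (cross-neg {p} {powL dL k} {q} {powL dL l} (cross e)) }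
            }
          ; comm = +C-comm
          }
        ; *-cong = *C-cong
        ; *-assoc = *C-assoc
        ; *-identity = *C-identityˡ , (λ x → ≈ᶠ-trans (*C-comm x 1C) (*C-identityˡ x))
        ; distrib =
            (λ z x y → ≈ᶠ-trans (*C-comm z _)
               (≈ᶠ-trans (*C-distribʳ z x y) (+C-cong (*C-comm x z) (*C-comm y z)))) ,
            *C-distribʳ
        }
      ; *-comm = *C-comm
      }
    }

-- q-difference equations over a ring in which 1 - qⁿ can be cancelled.

record InverseQPochhammer {c ℓ : Level} (A : CommutativeRing c ℓ) (q : CommutativeRing.Carrier A) : Set (c ⊔ ℓ) where
  open CommutativeRing A
  open Algebra.Properties.Semiring.Exp semiring using (_^_)
  field
    -- Stands for 1/(q;q)ₙ. The q-calculus uses it only through its recursion, whatever formula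
    -- produces the inverses.
    i      : ℕ → Carrier
    i-zero : i 0 ≈ 1#
    i-suc  : ∀ n → (1# - q ^ suc n) * i (suc n) ≈ i n
    1-qⁿ-cancel : ∀ n {a b} → (1# - q ^ suc n) * a ≈ (1# - q ^ suc n) * b → a ≈ b

module Combinations {c ℓ : Level} (R : CommutativeRing c ℓ) where
  open CommutativeRing R
  open RingSolver R
  open SetoidReasoning setoid

  private
    vanish : ∀ {a b} r → a ≈ b → r * (a - b) ≈ 0#
    vanish {b = b} r a≈b = trans (*-congˡ (trans (+-congʳ a≈b) (-‿inverseʳ b))) (zeroʳ r)

    add-zeros : ∀ {a r s t} → r ≈ 0# → s ≈ 0# → t ≈ 0# → a + (r + (s + t)) ≈ a
    add-zeros r≈0 s≈0 t≈0 = trans (+-congˡ (trans (+-cong r≈0 (trans (+-cong s≈0 t≈0) (+-identityˡ _))) (+-identityˡ _)))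
      (+-identityʳ _)

  -- A certificate of ideal membership: the two sides differ by the hypotheses weighted with the
  -- polynomials -1, 1 - σp, 1 + uy and -x, which the solver confirms. Here p stands for Φ, and the
  -- sides are F(qu)(1 + uY) and F(u)(1 - ua) expanded.
  shifted-defect : ∀ {x y p σx σy σp u a} → x - σx ≈ u * (y * σx) → x - y ≈ a → σx - σy ≈ a → p - σp ≈ u * (a * p) →
    (σx * σp - σy) + u * ((σx * σp - σy) * y) ≈ (x * p - y) + u * ((x * p - y) * - a)
  shifted-defect {x} {y} {p} {σx} {σy} {σp} {u} {a} e₁ e₂ e₂′ e₃ = trans
    (solve 8 (λ x y p σx σy σp u a →
      (σx :* σp :- σy) :+ u :* ((σx :* σp :- σy) :* y) :=
      ((x :* p :- y) :+ u :* ((x :* p :- y) :* (:- a)) :+ (:- con 1ℤ) :* (x :- y :- a))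
        :+ ((con 1ℤ :- σp) :* (x :- σx :- u :* (y :* σx))
            :+ ((con 1ℤ :+ u :* y) :* (σx :- σy :- a) :+ (:- x) :* (p :- σp :- u :* (a :* p)))))
      refl x y p σx σy σp u a)
    (trans (add-zeros (vanish _ e₁) (vanish _ e₂′) (vanish _ e₃))
      (trans (+-congˡ (vanish _ e₂)) (+-identityʳ _)))

  -- Write z both as y + d₂ and as x - (d₁ - d₂). Multiplying the second form by ξe turns x into y,
  -- and subtracting it from the first cancels y.
  solve-for-z : ∀ {x y z ξ e d₁ d₂} → x * (ξ * e) ≈ y → x - y ≈ d₁ → z - y ≈ d₂ →
    z * (1# - ξ * e) ≈ d₂ + ξ * ((d₁ - d₂) * e)
  solve-for-z {x} {y} {z} {ξ} {e} {d₁} {d₂} e₀ e₁ e₂ = trans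
    (solve 7 (λ x y z ξ e d₁ d₂ →
      z :* (con 1ℤ :- ξ :* e) :=
      (d₂ :+ ξ :* ((d₁ :- d₂) :* e))
        :+ ((:- con 1ℤ) :* (x :* (ξ :* e) :- y)
            :+ ((ξ :* e) :* (x :- y :- d₁) :+ (con 1ℤ :- ξ :* e) :* (z :- y :- d₂))))
      refl x y z ξ e d₁ d₂)
    (add-zeros (vanish _ e₀) (vanish _ e₁) (vanish _ e₂))

  -- Add and subtract F·σG. One factor ends up shifted and the other not, just as in the twisted
  -- Leibniz rule.
  product-rule : ∀ {F F′ σF G G′ σG u} → F - σF ≈ u * F′ → G - σG ≈ u * G′ →
    F * G - σF * σG ≈ u * (F′ * σG + G′ * F)
  product-rule {F} {F′} {σF} {G} {G′} {σG} {u} e e′ = trans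
    (solve 4 (λ F σF G σG → F :* G :- σF :* σG := (F :- σF) :* σG :+ (G :- σG) :* F) refl F σF G σG)
    (trans (+-cong (*-congʳ e) (*-congʳ e′))
      (solve 5 (λ F F′ G′ σG u → (u :* F′) :* σG :+ (u :* G′) :* F := u :* (F′ :* σG :+ G′ :* F))
        refl F F′ G′ σG u))

  factor-out : ∀ {A σA u b r} → A - σA ≈ u * (b * (A * r)) → A * (1# - b * (u * r)) ≈ σA
  factor-out {A} {σA} {u} {b} {r} e = trans
    (solve 5 (λ A σA u b r → A :* (con 1ℤ :- b :* (u :* r)) :=
      σA :+ con 1ℤ :* (A :- σA :- u :* (b :* (A :* r)))) refl A σA u b r)
    (trans (+-congˡ (vanish _ e)) (+-identityʳ _))

module QDifference {c ℓ : Level} (A : CommutativeRing c ℓ) (q : CommutativeRing.Carrier A)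
  (I : InverseQPochhammer A q) where
  open CommutativeRing A hiding (zero)
  open InverseQPochhammer I
  open PowerSeries A
  open RingSolver A
  open Algebra.Properties.Semiring.Exp semiring using (_^_)
  open Algebra.Properties.CommutativeSemiring.Exp commutativeSemiring using (^-distrib-*)
  open SetoidReasoning setoid

  σ : Series → Series
  σ = dilate q

  infix 4 _Δ_
  -- a(u) − a(qu) = u b(u)
  _Δ_ : Series → Series → Set ℓ
  a Δ b = a P.- σ a ≋ var P.* b

  Δ-intro : ∀ {a b} → (∀ n → (1# - q ^ suc n) * a (suc n) ≈ b n) → a Δ b
  Δ-intro {a} {b} eq = coeffwise λ
    { zero    → trans (solve 1 (λ x → x :- con 1ℤ :* x := con 0ℤ) refl (a 0)) (sym (conv-var-zero b))
    ; (suc n) → trans (solve 2 (λ x s → x :- s :* x := (con 1ℤ :- s) :* x) refl (a (suc n)) (q ^ suc n))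
                  (trans (eq n) (sym (conv-var-suc n b))) }

  Δ-elim : ∀ {a b} → a Δ b → ∀ n → (1# - q ^ suc n) * a (suc n) ≈ b n
  Δ-elim {a} {b} aΔb n =
    trans (solve 2 (λ x s → (con 1ℤ :- s) :* x := x :- s :* x) refl (a (suc n)) (q ^ suc n))
      (trans (coeff aΔb (suc n)) (conv-var-suc n b))

  Δ-cong : ∀ {a a' b b'} → a ≋ a' → b ≋ b' → a Δ b → a' Δ b'
  Δ-cong a≋a' b≋b' aΔb =
    P.trans (P.sym (P.+-cong a≋a' (P.-‿cong (dilate-cong q a≋a')))) (P.trans aΔb (P.*-congˡ b≋b'))

  -- The right-hand side k determines every coefficient in positive degree, by cancelling 1 - qⁿ⁺¹;
  -- only the constant terms are free.
  Δ-same : ∀ {a b k} → a Δ k → b Δ k → a P.- b ≋ ι (a 0 - b 0)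
  Δ-same {a} {b} {k} aΔk bΔk = coeffwise λ
    { zero    → refl
    ; (suc n) → trans (+-congʳ (1-qⁿ-cancel n (trans (Δ-elim aΔk n) (sym (Δ-elim bΔk n))))) (-‿inverseʳ _) }

  -- The series e_q(au) in u.
  qexp : Carrier → Series
  qexp a n = a ^ n * i n

  qexp-Δ : ∀ a → qexp a Δ ι a P.* qexp a
  qexp-Δ a = Δ-intro λ n → begin
    (1# - q ^ suc n) * (a * a ^ n * i (suc n))
      ≈⟨ solve 4 (λ d a p j → d :* (a :* p :* j) := a :* (p :* (d :* j))) refl _ a (a ^ n) (i (suc n)) ⟩
    a * (a ^ n * ((1# - q ^ suc n) * i (suc n)))
      ≈⟨ *-congˡ (*-congˡ (i-suc n)) ⟩
    a * (a ^ n * i n)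
      ≈⟨ conv-ι n a (qexp a) ⟨
    conv (ι a) (qexp a) n  ∎

  dilate-qexp : ∀ t a → dilate t (qexp a) ≋ qexp (t * a)
  dilate-qexp t a = coeffwise λ n → trans (sym (*-assoc _ _ _)) (*-congʳ (sym (^-distrib-* t a n)))

  dilate-dilate : ∀ s t a → dilate s (dilate t a) ≋ dilate (t * s) a
  dilate-dilate s t a = coeffwise λ n →
    trans (sym (*-assoc _ _ _)) (*-congʳ (trans (*-comm _ _) (sym (^-distrib-* t s n))))

  conv-null : ∀ n {a} b → (∀ j → j ≤ n → a j ≈ 0#) → conv a b n ≈ 0#
  conv-null zero    b a≈0 = trans (*-congʳ (a≈0 0 z≤n)) (zeroˡ _)
  conv-null (suc n) b a≈0 = trans
    (+-cong (trans (*-congʳ (a≈0 0 z≤n)) (zeroˡ _)) (conv-null n b λ j j≤n → a≈0 (suc j) (s≤s j≤n)))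
    (+-identityˡ _)

  -- Strong induction on the degree. In degree j + 1 the terms with a factor u involve only
  -- coefficients of f up to j, which vanish; what is left says that 1 - qʲ⁺¹ kills the next
  -- coefficient, for any g and h.
  homogeneous-zero : ∀ {f} g h → f 0 ≈ 0# → σ f P.+ var P.* (σ f P.* g) ≋ f P.+ var P.* (f P.* h) →
    f ≋ P.0#
  homogeneous-zero {f} g h f₀≈0 eq = coeffwise λ n → below (suc n) n ℕₚ.≤-refl
    where
    tail : ∀ j {a} b → (∀ k → k ≤ j → a k ≈ 0#) → conv var (conv a b) (suc j) ≈ 0#
    tail j b a≈0 = trans (conv-var-suc j _) (conv-null j b a≈0)
    step : ∀ j → (∀ k → k ≤ j → f k ≈ 0#) → f (suc j) ≈ 0#
    step j f≈0 = 1-qⁿ-cancel j (begin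
      (1# - q ^ suc j) * f (suc j)
        ≈⟨ solve 2 (λ s x → (con 1ℤ :- s) :* x := x :+ con 0ℤ :- (s :* x :+ con 0ℤ)) refl (q ^ suc j) (f (suc j)) ⟩
      f (suc j) + 0# - (σ f (suc j) + 0#)
        ≈⟨ +-cong (+-congˡ (tail j h f≈0))
             (-‿cong (+-congˡ (tail j g λ k k≤j → trans (*-congˡ (f≈0 k k≤j)) (zeroʳ _)))) ⟨
      f (suc j) + conv var (conv f h) (suc j) - (σ f (suc j) + conv var (conv (σ f) g) (suc j))
        ≈⟨ +-congˡ (-‿cong (coeff eq (suc j))) ⟩
      f (suc j) + conv var (conv f h) (suc j) - (f (suc j) + conv var (conv f h) (suc j))
        ≈⟨ -‿inverseʳ _ ⟩
      0#
        ≈⟨ zeroʳ _ ⟨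
      (1# - q ^ suc j) * 0#  ∎)
    below : ∀ n j → j < n → f j ≈ 0#
    below (suc n) zero    _         = f₀≈0
    below (suc n) (suc j) (s≤s j<n) = step j λ k k≤j → below n k (ℕₚ.≤-trans (s≤s k≤j) j<n)

  module Riccati {Fx Fy Fz : Series} {x y z ξ : Carrier}
    (Fx₀ : Fx 0 ≈ x) (Fy₀ : Fy 0 ≈ y) (Fz₀ : Fz 0 ≈ z) (xξ≈y : x * ξ ≈ y)
    (FxΔ : Fx Δ Fy P.* σ Fx) (FyΔ : Fy Δ Fy P.* σ Fx) (FzΔ : Fz Δ Fy P.* σ Fx) where

    private
      Fx-Fy : Fx P.- Fy ≋ ι (x - y)
      Fx-Fy = P.trans (Δ-same FxΔ FyΔ) (ι-cong (+-cong Fx₀ (-‿cong Fy₀)))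

      Fz-Fy : Fz P.- Fy ≋ ι (z - y)
      Fz-Fy = P.trans (Δ-same FzΔ FyΔ) (ι-cong (+-cong Fz₀ (-‿cong Fy₀)))

      σFx-σFy : σ Fx P.- σ Fy ≋ ι (x - y)
      σFx-σFy = P.trans (P.+-congˡ (P.sym (dilate-‿- q Fy)))
        (P.trans (P.sym (dilate-+ q Fx (P.- Fy))) (P.trans (dilate-cong q Fx-Fy) (dilate-ι q (x - y))))

      Ex Φ : Series
      Ex = qexp (x - y)
      Φ = ι ξ P.* Ex

      Φ-Δ : Φ Δ ι (x - y) P.* Φ
      Φ-Δ = Δ-intro λ n → begin
        (1# - q ^ suc n) * conv (ι ξ) Ex (suc n)
          ≈⟨ *-congˡ (conv-ι (suc n) ξ Ex) ⟩
        (1# - q ^ suc n) * (ξ * Ex (suc n))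
          ≈⟨ solve 3 (λ d s e → d :* (s :* e) := s :* (d :* e)) refl _ ξ (Ex (suc n)) ⟩
        ξ * ((1# - q ^ suc n) * Ex (suc n))
          ≈⟨ *-congˡ (trans (Δ-elim (qexp-Δ (x - y)) n) (conv-ι n (x - y) Ex)) ⟩
        ξ * ((x - y) * Ex n)
          ≈⟨ solve 3 (λ s a e → s :* (a :* e) := a :* (s :* e)) refl ξ (x - y) (Ex n) ⟩
        (x - y) * (ξ * Ex n)
          ≈⟨ *-congˡ (conv-ι n ξ Ex) ⟨
        (x - y) * Φ n
          ≈⟨ conv-ι n (x - y) Φ ⟨
        conv (ι (x - y)) Φ n  ∎

      defect : Series
      defect = Fx P.* Φ P.- Fy

      σ-defect : σ defect ≋ σ Fx P.* σ Φ P.- σ Fy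
      σ-defect = P.trans (dilate-+ q (Fx P.* Φ) (P.- Fy)) (P.+-cong (dilate-* q Fx Φ) (dilate-‿- q Fy))

      defect-zero : defect ≋ P.0#
      defect-zero = homogeneous-zero Fy (P.- ι (x - y)) defect₀
        (P.trans (P.+-cong σ-defect (P.*-congˡ (P.*-congʳ σ-defect)))
          (Combinations.shifted-defect powerSeries FxΔ Fx-Fy σFx-σFy Φ-Δ))
        where
        -- The factor ξ in Φ is fixed by this requirement: e_q has constant term 1, so the constant
        -- term of the defect is xξ - y.
        defect₀ : defect 0 ≈ 0#
        defect₀ = begin
          Fx 0 * (ξ * (1# * i 0)) - Fy 0
            ≈⟨ +-cong (*-cong Fx₀ (*-congˡ (trans (*-identityˡ _) i-zero))) (-‿cong Fy₀) ⟩
          x * (ξ * 1#) - y   ≈⟨ +-congʳ (*-congˡ (*-identityʳ ξ)) ⟩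
          x * ξ - y          ≈⟨ +-congʳ xξ≈y ⟩
          y - y              ≈⟨ -‿inverseʳ y ⟩
          0#                 ∎

    closed-form : Fz P.* (P.1# P.- ι ξ P.* qexp (x - y)) ≋ ι (z - y) P.+ ι ξ P.* (ι (x - z) P.* qexp (x - y))
    closed-form = P.trans
      (Combinations.solve-for-z powerSeries (x∙y⁻¹≈ε⇒x≈y _ _ defect-zero) Fx-Fy Fz-Fy)
      (P.+-congˡ (P.*-congˡ (P.*-congʳ (P.trans
        (P.+-congˡ (P.sym (ι-‿- (z - y))))
        (P.trans (P.sym (ι-+ (x - y) (- (z - y))))
          (ι-cong (solve 3 (λ x y z → x :- y :- (z :- y) := x :- z) refl x y z)))))))
      where open import Algebra.Properties.AbelianGroup P.+-abelianGroup using (x∙y⁻¹≈ε⇒x≈y)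

-- The twisted derivative on words.

module WordDerivative {c ℓ : Level} (K : CommutativeRing c ℓ) (β : CommutativeRing.Carrier K) where
  open Cyc K β

  -- The operator q·↑ on a single term.
  shiftT : Term → Term
  shiftT (tm b j w) = tm b (suc j) (up w)

  rmulW-++ : ∀ f g w → rmulW (f ++ g) w ≡ rmulW f w ++ rmulW g w
  rmulW-++ f g w = map-++ _ f g

  lmulW-++ : ∀ w f g → lmulW w (f ++ g) ≡ lmulW w f ++ lmulW w g
  lmulW-++ w f g = map-++ _ f g

  rmulW-rmulW : ∀ f v w → rmulW (rmulW f v) w ≡ rmulW f (v ++ w)
  rmulW-rmulW []             v w = ≡.refl
  rmulW-rmulW (tm b j u ∷ f) v w = ≡.cong₂ _∷_ (≡.cong (tm b j) (++-assoc u v w)) (rmulW-rmulW f v w)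

  lmulW-rmulW : ∀ v f w → rmulW (lmulW v f) w ≡ lmulW v (rmulW f w)
  lmulW-rmulW v []             w = ≡.refl
  lmulW-rmulW v (tm b j u ∷ f) w = ≡.cong₂ _∷_ (≡.cong (tm b j) (++-assoc v u w)) (lmulW-rmulW v f w)

  lmulW-lmulW : ∀ v w f → lmulW v (lmulW w f) ≡ lmulW (v ++ w) f
  lmulW-lmulW v w []             = ≡.refl
  lmulW-lmulW v w (tm b j u ∷ f) = ≡.cong₂ _∷_ (≡.cong (tm b j) (≡.sym (++-assoc v w u))) (lmulW-lmulW v w f)

  lmulW-[] : ∀ f → lmulW [] f ≡ f
  lmulW-[] []             = ≡.refl
  lmulW-[] (tm b j u ∷ f) = ≡.cong (tm b j u ∷_) (lmulW-[] f)

  up-++ : ∀ v w → up (v ++ w) ≡ up v ++ up w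
  up-++ v w = map-++ _ v w

  shiftT-rmulW : ∀ f w → map shiftT (rmulW f w) ≡ rmulW (map shiftT f) (up w)
  shiftT-rmulW []             w = ≡.refl
  shiftT-rmulW (tm b j u ∷ f) w = ≡.cong₂ _∷_ (≡.cong (tm b (suc j)) (up-++ u w)) (shiftT-rmulW f w)

  shiftT-lmulW : ∀ w f → map shiftT (lmulW w f) ≡ lmulW (up w) (map shiftT f)
  shiftT-lmulW w []             = ≡.refl
  shiftT-lmulW w (tm b j u ∷ f) = ≡.cong₂ _∷_ (≡.cong (tm b (suc j)) (up-++ w u)) (shiftT-lmulW w f)

  -- The exponent of q in each rule equals the index of the letter, so raising all indices by one
  -- costs exactly one factor q.
  R-shift : ∀ s j b → R (lt s (suc j) b) ≡ map shiftT (R (lt s j b))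
  R-shift X j false = ≡.refl
  R-shift Y j false = ≡.refl
  R-shift Z j false = ≡.refl
  R-shift E j false = ≡.refl
  R-shift X j true  = ≡.refl
  R-shift Y j true  = ≡.refl
  R-shift Z j true  = ≡.refl
  R-shift E j true  = ≡.refl

  -- Holds as an equality of lists: the derivatives of the letters of v come first on both sides, in
  -- the same order, so no terms have to be permuted or collected.
  Dw-++ : ∀ v w → Dw (v ++ w) ≡ rmulW (Dw v) (up w) ++ lmulW v (Dw w)
  Dw-++ []      w = ≡.sym (lmulW-[] (Dw w))
  Dw-++ (l ∷ v) w = begin
    rmulW (R l) (up (v ++ w)) ++ lmulW (l ∷ []) (Dw (v ++ w))
      ≡⟨ ≡.cong₂ (λ u f → rmulW (R l) u ++ lmulW (l ∷ []) f) (up-++ v w) (Dw-++ v w) ⟩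
    rmulW (R l) (up v ++ up w) ++ lmulW (l ∷ []) (rmulW (Dw v) (up w) ++ lmulW v (Dw w))
      ≡⟨ ≡.cong₂ _++_ (≡.sym (rmulW-rmulW (R l) (up v) (up w)))
           (≡.trans (lmulW-++ (l ∷ []) (rmulW (Dw v) (up w)) _)
             (≡.cong₂ _++_ (≡.sym (lmulW-rmulW (l ∷ []) (Dw v) (up w))) (lmulW-lmulW (l ∷ []) v (Dw w)))) ⟩
    rmulW (rmulW (R l) (up v)) (up w) ++ (rmulW (lmulW (l ∷ []) (Dw v)) (up w) ++ lmulW (l ∷ v) (Dw w))
      ≡⟨ ++-assoc (rmulW (rmulW (R l) (up v)) (up w)) _ _ ⟨
    (rmulW (rmulW (R l) (up v)) (up w) ++ rmulW (lmulW (l ∷ []) (Dw v)) (up w)) ++ lmulW (l ∷ v) (Dw w)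
      ≡⟨ ≡.cong (_++ lmulW (l ∷ v) (Dw w)) (rmulW-++ (rmulW (R l) (up v)) _ (up w)) ⟨
    rmulW (Dw (l ∷ v)) (up w) ++ lmulW (l ∷ v) (Dw w)  ∎
    where open ≡.≡-Reasoning

  Dw-up : ∀ w → Dw (up w) ≡ map shiftT (Dw w)
  Dw-up []               = ≡.refl
  Dw-up (lt s j b ∷ w) = begin
    rmulW (R (lt s (suc j) b)) (up (up w)) ++ lmulW (lt s (suc j) b ∷ []) (Dw (up w))
      ≡⟨ ≡.cong₂ (λ f g → rmulW f (up (up w)) ++ lmulW (lt s (suc j) b ∷ []) g) (R-shift s j b) (Dw-up w) ⟩
    rmulW (map shiftT (R (lt s j b))) (up (up w)) ++ lmulW (up (lt s j b ∷ [])) (map shiftT (Dw w))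
      ≡⟨ ≡.cong₂ _++_ (shiftT-rmulW (R (lt s j b)) (up w)) (shiftT-lmulW (lt s j b ∷ []) (Dw w)) ⟨
    map shiftT (rmulW (R (lt s j b)) (up w)) ++ map shiftT (lmulW (lt s j b ∷ []) (Dw w))
      ≡⟨ map-++ shiftT (rmulW (R (lt s j b)) (up w)) _ ⟨
    map shiftT (Dw (lt s j b ∷ w))  ∎
    where open ≡.≡-Reasoning

-- Generating series of words and the q-difference equations of the letters.

module WordSeries {c ℓ c′ ℓ′ : Level} (K : CommutativeRing c ℓ) (β : CommutativeRing.Carrier K)
  (A : CommutativeRing c′ ℓ′) (q : CommutativeRing.Carrier A) (I : InverseQPochhammer A q)
  (ρ : CommutativeRing.Carrier K → CommutativeRing.Carrier A)
  (ρ-1 : CommutativeRing._≈_ A (ρ (CommutativeRing.1# K)) (CommutativeRing.1# A))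
  (ρ-* : ∀ a b → CommutativeRing._≈_ A (ρ (CommutativeRing._*_ K a b)) (CommutativeRing._*_ A (ρ a) (ρ b)))
  (μ : Word → CommutativeRing.Carrier A)
  (μ-++ : ∀ v w → CommutativeRing._≈_ A (μ (v ++ w)) (CommutativeRing._*_ A (μ v) (μ w)))
  (μ-up : ∀ w → CommutativeRing._≈_ A (μ (up w)) (μ w)) where
  open Cyc K β using (Elm; Term; tm; scaleT; Dw; D; Dⁿ; rmulW; lmulW; gen)
  open WordDerivative K β
  open CommutativeRing A hiding (zero)
  open InverseQPochhammer I
  open PowerSeries A
  open QDifference A q I
  open RingSolver A
  open Algebra.Properties.Semiring.Exp semiring using (_^_; ^-homo-*)
  open Algebra.Properties.CommutativeSemiring.Exp commutativeSemiring using (^-distrib-*)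
  open SetoidReasoning setoid

  -- The linear extension of h from words to 𝔼. Keeping h variable, instead of fixing it to the
  -- image under `φ`, is what allows `D` to be transposed.
  eval : Elm → (Word → Carrier) → Carrier
  eval []             h = 0#
  eval (tm b j w ∷ f) h = ρ b * q ^ j * h w + eval f h

  eval-cong : ∀ f {h h'} → (∀ w → h w ≈ h' w) → eval f h ≈ eval f h'
  eval-cong []             h≈h' = refl
  eval-cong (tm b j w ∷ f) h≈h' = +-cong (*-congˡ (h≈h' w)) (eval-cong f h≈h')

  eval-++ : ∀ f g h → eval (f ++ g) h ≈ eval f h + eval g h
  eval-++ []             g h = sym (+-identityˡ _)
  eval-++ (tm b j w ∷ f) g h = trans (+-congˡ (eval-++ f g h)) (sym (+-assoc _ _ _))

  eval-*ʳ : ∀ f h a → eval f (λ w → h w * a) ≈ eval f h * a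
  eval-*ʳ []             h a = sym (zeroˡ a)
  eval-*ʳ (tm b j w ∷ f) h a = trans (+-congˡ (eval-*ʳ f h a))
    (solve 4 (λ r x e a → r :* (x :* a) :+ e :* a := (r :* x :+ e) :* a) refl (ρ b * q ^ j) (h w) (eval f h) a)

  eval-scaleT : ∀ a k f h → eval (map (scaleT a k) f) h ≈ ρ a * q ^ k * eval f h
  eval-scaleT a k []             h = sym (zeroʳ _)
  eval-scaleT a k (tm b j w ∷ f) h = trans
    (+-cong (*-congʳ (*-cong (ρ-* a b) (^-homo-* q k j))) (eval-scaleT a k f h))
    (solve 6 (λ a b s t x e → (a :* b) :* (s :* t) :* x :+ a :* s :* e := a :* s :* (b :* t :* x :+ e))
      refl (ρ a) (ρ b) (q ^ k) (q ^ j) (h w) (eval f h))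

  eval-shiftT : ∀ f h → eval (map shiftT f) h ≈ q * eval f (h ∘ up)
  eval-shiftT []             h = sym (zeroʳ q)
  eval-shiftT (tm b j w ∷ f) h = trans (+-congˡ (eval-shiftT f h))
    (solve 5 (λ b q s x e → b :* (q :* s) :* x :+ q :* e := q :* (b :* s :* x :+ e))
      refl (ρ b) q (q ^ j) (h (up w)) (eval f (h ∘ up)))

  eval-rmulW : ∀ f v h → eval (rmulW f v) h ≡ eval f (λ w → h (w ++ v))
  eval-rmulW []             v h = ≡.refl
  eval-rmulW (tm b j w ∷ f) v h = ≡.cong (ρ b * q ^ j * h (w ++ v) +_) (eval-rmulW f v h)

  eval-lmulW : ∀ v f h → eval (lmulW v f) h ≡ eval f (λ w → h (v ++ w))
  eval-lmulW v []             h = ≡.refl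
  eval-lmulW v (tm b j w ∷ f) h = ≡.cong (ρ b * q ^ j * h (v ++ w) +_) (eval-lmulW v f h)

  -- The adjoint of D for eval.
  D* : (Word → Carrier) → Word → Carrier
  D* h w = eval (Dw w) h

  eval-D : ∀ f h → eval (D f) h ≈ eval f (D* h)
  eval-D []             h = refl
  eval-D (tm b j w ∷ f) h = trans (eval-++ (map (scaleT b j) (Dw w)) (D f) h)
    (+-cong (eval-scaleT b j (Dw w) h) (eval-D f h))

  D*ⁿ : ℕ → (Word → Carrier) → Word → Carrier
  D*ⁿ zero    h = h
  D*ⁿ (suc n) h = D* (D*ⁿ n h)

  D*ⁿ-D* : ∀ n h → D*ⁿ n (D* h) ≡ D* (D*ⁿ n h)
  D*ⁿ-D* zero    h = ≡.refl
  D*ⁿ-D* (suc n) h = ≡.cong D* (D*ⁿ-D* n h)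

  eval-Dⁿ : ∀ n f h → eval (Dⁿ n f) h ≈ eval f (D*ⁿ n h)
  eval-Dⁿ zero    f h = refl
  eval-Dⁿ (suc n) f h = begin
    eval (D (Dⁿ n f)) h        ≈⟨ eval-D (Dⁿ n f) h ⟩
    eval (Dⁿ n f) (D* h)       ≈⟨ eval-Dⁿ n f (D* h) ⟩
    eval f (D*ⁿ n (D* h))      ≡⟨ ≡.cong (eval f) (D*ⁿ-D* n h) ⟩
    eval f (D*ⁿ (suc n) h)     ∎

  -- φ(Gen(w; u)) with the iterates of `D` transposed onto `μ`, so that a recursion on n can treat
  -- all words simultaneously.
  γ : Word → Series
  γ w n = D*ⁿ n μ w * i n

  γᴱ : Elm → Series
  γᴱ f n = eval f (λ w → γ w n)

  -- The factor 1 - qⁿ⁺¹ turns 1/(q;q)ₙ₊₁ into 1/(q;q)ₙ, and the outermost `D*` is by definition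
  -- evaluation on `Dw w`.
  γ-Δ : ∀ w → γ w Δ γᴱ (Dw w)
  γ-Δ w = Δ-intro λ n → begin
    (1# - q ^ suc n) * (D*ⁿ (suc n) μ w * i (suc n))
      ≈⟨ solve 3 (λ d g j → d :* (g :* j) := g :* (d :* j)) refl _ _ (i (suc n)) ⟩
    D*ⁿ (suc n) μ w * ((1# - q ^ suc n) * i (suc n))
      ≈⟨ *-congˡ (i-suc n) ⟩
    eval (Dw w) (D*ⁿ n μ) * i n
      ≈⟨ eval-*ʳ (Dw w) (D*ⁿ n μ) (i n) ⟨
    eval (Dw w) (λ v → γ v n)  ∎

  -- Each differentiation of a raised word yields one q, and after the last one `μ` forgets the
  -- indices.
  D*ⁿ-up : ∀ n w → D*ⁿ n μ (up w) ≈ q ^ n * D*ⁿ n μ w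
  D*ⁿ-up zero    w = trans (μ-up w) (sym (*-identityˡ _))
  D*ⁿ-up (suc n) w = begin
    eval (Dw (up w)) (D*ⁿ n μ)                     ≡⟨ ≡.cong (λ f → eval f (D*ⁿ n μ)) (Dw-up w) ⟩
    eval (map shiftT (Dw w)) (D*ⁿ n μ)             ≈⟨ eval-shiftT (Dw w) (D*ⁿ n μ) ⟩
    q * eval (Dw w) (λ v → D*ⁿ n μ (up v))
      ≈⟨ *-congˡ (eval-cong (Dw w) (λ v → trans (D*ⁿ-up n v) (*-comm _ _))) ⟩
    q * eval (Dw w) (λ v → D*ⁿ n μ v * q ^ n)      ≈⟨ *-congˡ (eval-*ʳ (Dw w) (D*ⁿ n μ) (q ^ n)) ⟩
    q * (eval (Dw w) (D*ⁿ n μ) * q ^ n)            ≈⟨ solve 3 (λ q e s → q :* (e :* s) := q :* s :* e) refl q _ (q ^ n) ⟩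
    q ^ suc n * eval (Dw w) (D*ⁿ n μ)              ∎

  γ-up : ∀ w → γ (up w) ≋ σ (γ w)
  γ-up w = coeffwise λ n → trans (*-congʳ (D*ⁿ-up n w)) (*-assoc _ _ _)

  γᴱ-* : ∀ f b n → eval f (λ w → conv (γ w) b n) ≈ conv (γᴱ f) b n
  γᴱ-* []             b n = sym (conv-zeroˡ n b)
  γᴱ-* (tm a j w ∷ f) b n = begin
    r * conv (γ w) b n + eval f (λ w → conv (γ w) b n)
      ≈⟨ +-cong (sym (conv-scale n r (γ w) b)) (γᴱ-* f b n) ⟩
    conv (λ k → r * γ w k) b n + conv (γᴱ f) b n
      ≈⟨ conv-distribʳ n b (λ k → r * γ w k) (γᴱ f) ⟨
    conv (γᴱ (tm a j w ∷ f)) b n  ∎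
    where r = ρ a * q ^ j

  -- Both sides satisfy the q-difference equation coming from the twisted
  -- Leibniz rule, so their coefficients agree recursively.
  γ-++ : ∀ v w → γ (v ++ w) ≋ γ v P.* γ w
  γ-++ v w = coeffwise λ n → go n v w
    where
    leibniz : ∀ v w → γ v P.* γ w Δ (γᴱ (Dw v) P.* σ (γ w) P.+ γᴱ (Dw w) P.* γ v)
    leibniz v w = P.trans (P.+-congˡ (P.-‿cong (dilate-* q (γ v) (γ w))))
      (product-rule (γ-Δ v) (γ-Δ w))
      where open Combinations powerSeries using (product-rule)
    go : ∀ n v w → γ (v ++ w) n ≈ conv (γ v) (γ w) n
    go zero v w = begin
      μ (v ++ w) * i 0       ≈⟨ *-cong (μ-++ v w) i-zero ⟩
      μ v * μ w * 1#         ≈⟨ solve 2 (λ x y → x :* y :* con 1ℤ := (x :* con 1ℤ) :* (y :* con 1ℤ)) refl (μ v) (μ w) ⟩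
      μ v * 1# * (μ w * 1#)  ≈⟨ *-cong (*-congˡ i-zero) (*-congˡ i-zero) ⟨
      μ v * i 0 * (μ w * i 0)  ∎
    go (suc n) v w = 1-qⁿ-cancel n (begin
      (1# - q ^ suc n) * γ (v ++ w) (suc n)
        ≈⟨ Δ-elim (γ-Δ (v ++ w)) n ⟩
      eval (Dw (v ++ w)) (λ u → γ u n)
        ≡⟨ ≡.cong (λ f → eval f (λ u → γ u n)) (Dw-++ v w) ⟩
      eval (rmulW (Dw v) (up w) ++ lmulW v (Dw w)) (λ u → γ u n)
        ≈⟨ eval-++ (rmulW (Dw v) (up w)) (lmulW v (Dw w)) _ ⟩
      eval (rmulW (Dw v) (up w)) (λ u → γ u n) + eval (lmulW v (Dw w)) (λ u → γ u n)
        ≡⟨ ≡.cong₂ _+_ (eval-rmulW (Dw v) (up w) _) (eval-lmulW v (Dw w) _) ⟩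
      eval (Dw v) (λ u → γ (u ++ up w) n) + eval (Dw w) (λ u → γ (v ++ u) n)
        -- The induction hypothesis is needed for all pairs of words. The twisted Leibniz rule
        -- leaves ↑w, whose series is σ(γ w): this is the shifted factor of the q-product rule.
        ≈⟨ +-cong
             (eval-cong (Dw v) λ u → trans (go n u (up w)) (conv-cong n (λ _ → refl) (coeff (γ-up w))))
             (eval-cong (Dw w) λ u → trans (go n v u) (conv-comm n (γ v) (γ u))) ⟩
      eval (Dw v) (λ u → conv (γ u) (σ (γ w)) n) + eval (Dw w) (λ u → conv (γ u) (γ v) n)
        ≈⟨ +-cong (γᴱ-* (Dw v) (σ (γ w)) n) (γᴱ-* (Dw w) (γ v) n) ⟩
      conv (γᴱ (Dw v)) (σ (γ w)) n + conv (γᴱ (Dw w)) (γ v) n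
        ≈⟨ Δ-elim (leibniz v w) n ⟨
      (1# - q ^ suc n) * conv (γ v) (γ w) (suc n)  ∎)

  letter : Sym → ℕ → Series
  letter s j = γ (lt s j false ∷ [])

  γᴱ-yx : ∀ {n} → γᴱ (tm (CommutativeRing.1# K) 0 (lt Y 0 false ∷ lt X 1 false ∷ []) ∷ []) n ≈
    conv (letter Y 0) (σ (letter X 0)) n
  γᴱ-yx {n} = begin
    ρ (CommutativeRing.1# K) * 1# * γ yx n + 0#  ≈⟨ +-congʳ (*-congʳ (*-congʳ ρ-1)) ⟩
    1# * 1# * γ yx n + 0#
      ≈⟨ solve 1 (λ g → con 1ℤ :* con 1ℤ :* g :+ con 0ℤ := g) refl (γ yx n) ⟩
    γ yx n
      ≈⟨ coeff (γ-++ (lt Y 0 false ∷ []) (lt X 1 false ∷ [])) n ⟩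
    conv (letter Y 0) (letter X 1) n
      ≈⟨ coeff (P.*-congˡ {letter Y 0} (γ-up (lt X 0 false ∷ []))) n ⟩
    conv (letter Y 0) (σ (letter X 0)) n  ∎
    where yx = lt Y 0 false ∷ lt X 1 false ∷ []

  letter-zero : ∀ s j → letter s j 0 ≈ μ (lt s j false ∷ [])
  letter-zero s j = trans (*-congˡ i-zero) (*-identityʳ _)

  X-Δ : letter X 0 Δ letter Y 0 P.* σ (letter X 0)
  X-Δ = Δ-cong P.refl (coeffwise λ n → γᴱ-yx) (γ-Δ _)

  Y-Δ : letter Y 0 Δ letter Y 0 P.* σ (letter X 0)
  Y-Δ = Δ-cong P.refl (coeffwise λ n → γᴱ-yx) (γ-Δ _)

  Z-Δ : letter Z 0 Δ letter Y 0 P.* σ (letter X 0)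
  Z-Δ = Δ-cong P.refl (coeffwise λ n → γᴱ-yx) (γ-Δ _)

  E-Δ : letter E 0 Δ ι (ρ β) P.* (letter E 0 P.* σ (letter Z 0))
  E-Δ = Δ-cong P.refl (coeffwise λ n → begin
    ρ β * 1# * γ ez n + 0#                            ≈⟨ solve 2 (λ b g → b :* con 1ℤ :* g :+ con 0ℤ := b :* g) refl (ρ β) (γ ez n) ⟩
    ρ β * γ ez n                                      ≈⟨ *-congˡ (coeff (γ-++ (lt E 0 false ∷ []) (lt Z 1 false ∷ [])) n) ⟩
    ρ β * conv (letter E 0) (letter Z 1) n
      ≈⟨ *-congˡ (coeff (P.*-congˡ {letter E 0} (γ-up (lt Z 0 false ∷ []))) n) ⟩
    ρ β * conv (letter E 0) (σ (letter Z 0)) n        ≈⟨ conv-ι n (ρ β) _ ⟨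
    conv (ι (ρ β)) (letter E 0 P.* σ (letter Z 0)) n  ∎) (γ-Δ _)
    where ez = lt E 0 false ∷ lt Z 1 false ∷ []

-- Inverses of the q-Pochhammer symbols.

module QPochhammer {c ℓ : Level} (A : CommutativeRing c ℓ) (q : CommutativeRing.Carrier A) where
  open CommutativeRing A hiding (zero)
  open RingSolver A
  open PowerSeries A
  open Algebra.Properties.Semiring.Exp semiring using (_^_)
  open SetoidReasoning setoid

  qpoch : ℕ → Carrier
  qpoch zero    = 1#
  qpoch (suc n) = qpoch n * (1# - q ^ suc n)

  fromInverse : (i : ℕ → Carrier) → (∀ n → qpoch n * i n ≈ 1#) → InverseQPochhammer A q
  fromInverse i inv = record
    { i           = i
    ; i-zero      = trans (sym (*-identityˡ _)) (inv 0)
    ; i-suc       = λ n → begin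
        (1# - q ^ suc n) * i (suc n)                          ≈⟨ *-identityˡ _ ⟨
        1# * ((1# - q ^ suc n) * i (suc n))                   ≈⟨ *-congʳ (inv n) ⟨
        qpoch n * i n * ((1# - q ^ suc n) * i (suc n))
          ≈⟨ solve 4 (λ p j d k → p :* j :* (d :* k) := j :* (p :* d :* k)) refl (qpoch n) (i n) _ (i (suc n)) ⟩
        i n * (qpoch (suc n) * i (suc n))                     ≈⟨ *-congˡ (inv (suc n)) ⟩
        i n * 1#                                              ≈⟨ *-identityʳ _ ⟩
        i n                                                   ∎
    ; 1-qⁿ-cancel = λ n {a} {b} e → trans (sym (recover n a)) (trans (*-congˡ e) (recover n b))
    }
    where
    -- As a divisor of the invertible (q;q)ₙ₊₁, the element 1 - qⁿ⁺¹ is itself invertible, with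
    -- inverse `qpoch n * i (suc n)`.
    recover : ∀ n a → (qpoch n * i (suc n)) * ((1# - q ^ suc n) * a) ≈ a
    recover n a = begin
      (qpoch n * i (suc n)) * ((1# - q ^ suc n) * a)
        ≈⟨ solve 4 (λ p j d a → (p :* j) :* (d :* a) := (p :* d :* j) :* a) refl (qpoch n) (i (suc n)) _ a ⟩
      qpoch (suc n) * i (suc n) * a  ≈⟨ *-congʳ (inv (suc n)) ⟩
      1# * a                         ≈⟨ *-identityˡ a ⟩
      a                              ∎

  -- The inverses of (q;q)ₙ are defined as series in u as well as q, and must be seen to be free of
  -- u. In positive degree a·bₙ₊₁ = 0; multiply by b₀, the inverse of a.
  inverse-constant : ∀ {a b} → ι a P.* b ≋ P.1# → b ≋ ι (b 0)
  inverse-constant {a} {b} e = coeffwise λ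
    { zero    → refl
    ; (suc n) → begin
        b (suc n)                ≈⟨ *-identityˡ _ ⟨
        1# * b (suc n)           ≈⟨ *-congʳ (coeff e 0) ⟨
        a * b 0 * b (suc n)      ≈⟨ solve 3 (λ a b c → a :* b :* c := b :* (a :* c)) refl a (b 0) (b (suc n)) ⟩
        b 0 * (a * b (suc n))    ≈⟨ *-congˡ (trans (sym (conv-ι (suc n) a b)) (coeff e (suc n))) ⟩
        b 0 * 0#                 ≈⟨ zeroʳ _ ⟩
        0#                       ∎ }

  -- The k-th summand lives in degree k alone, so degree n of the truncated sum sees only its last
  -- summand.
  sum-monomials : ∀ {T : ℕ → Series} {a b : ℕ → Carrier} → (∀ k → T k ≋ ι (a k) P.* (var ^ᵖ k P.* ι (b k))) →
    ∀ n → Sum.sum A (suc n) (λ k → T k n) ≈ a n * b n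
  sum-monomials {T} {a} {b} T≋ n = trans
    (Sum.sum-last A n λ k k<n → trans (at k) (trans (*-congˡ (var-above k<n (b k))) (zeroʳ _)))
    (trans (at n) (*-congˡ (var-diag n (ι (b n)))))
    where
    at : ∀ k → T k n ≈ a k * (var ^ᵖ k P.* ι (b k)) n
    at k = trans (coeff (T≋ k) n) (conv-ι n (a k) _)

-- Series in u and q: products, geometric series and substitution.

module DoubleSeries {c ℓ : Level} (C : CommutativeRing c ℓ) where
  open CommutativeRing C hiding (zero)
  open Sum C
  open Algebra.Properties.Ring ring using (-0#≈0#)

  module C⟦q⟧ = PowerSeries C
  A : CommutativeRing c ℓ
  A = C⟦q⟧.powerSeries
  module C⟦q,u⟧ = PowerSeries A
  -- Series in u over series in q: the carrier unfolds to ℕ → ℕ → `Carrier` with the degree in u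
  -- first, as in `Ser`.
  S : CommutativeRing c ℓ
  S = C⟦q,u⟧.powerSeries
  module A = CommutativeRing A
  module S = CommutativeRing S
  open C⟦q,u⟧ using (_^ᵖ_)
  open RingSolver S

  open C⟦q,u⟧ public using (_≋_)

  ≋-intro : ∀ {a b} → (∀ n m → a n m ≈ b n m) → a ≋ b
  ≋-intro a≈b = C⟦q,u⟧.coeffwise λ n → C⟦q⟧.coeffwise (a≈b n)

  ≋-elim : ∀ {a b} → a ≋ b → ∀ n m → a n m ≈ b n m
  ≋-elim a≋b n m = C⟦q⟧.coeff (C⟦q,u⟧.coeff a≋b n) m

  infixl 7 _⊛_
  -- The double-sum form in which the definitions state the product; `⊛≋*` gives access to the ring
  -- laws.
  _⊛_ : S.Carrier → S.Carrier → S.Carrier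
  (a ⊛ b) n m = sum (suc n) (λ i → sum (suc m) (λ j → a i j * b (n ∸ i) (m ∸ j)))

  sum-pointwise : ∀ k (F : ℕ → A.Carrier) m → Sum.sum A k F m ≡ sum k (λ i → F i m)
  sum-pointwise zero    F m = ≡.refl
  sum-pointwise (suc k) F m = ≡.cong (_+ F k m) (sum-pointwise k F m)

  ⊛≋* : ∀ a b → a ⊛ b ≋ a S.* b
  ⊛≋* a b = ≋-intro λ n m → begin
    sum (suc n) (λ i → sum (suc m) (λ j → a i j * b (n ∸ i) (m ∸ j)))
      ≈⟨ sum-cong (suc n) (λ i → C⟦q⟧.conv-sum m (a i) (b (n ∸ i))) ⟨
    sum (suc n) (λ i → (a i A.* b (n ∸ i)) m)
      ≡⟨ sum-pointwise (suc n) (λ i → a i A.* b (n ∸ i)) m ⟨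
    Sum.sum A (suc n) (λ i → a i A.* b (n ∸ i)) m
      ≈⟨ C⟦q⟧.coeff (C⟦q,u⟧.conv-sum n a b) m ⟨
    (a S.* b) n m  ∎
    where open SetoidReasoning setoid

  -- Lets either factor be replaced by one that agrees with it only up to the degrees under
  -- consideration, as every truncation argument requires.
  *-local : ∀ n m {a a' b b'} → (∀ i j → i ≤ n → j ≤ m → a i j ≈ a' i j) →
    (∀ i j → i ≤ n → j ≤ m → b i j ≈ b' i j) → (a S.* b) n m ≈ (a' S.* b') n m
  *-local n m {a} {a'} {b} {b'} a≈a' b≈b' = begin
    (a S.* b) n m   ≈⟨ ≋-elim (⊛≋* a b) n m ⟨
    (a ⊛ b) n m
      ≈⟨ sum-cong< (suc n) (λ { i (s≤s i≤n) → sum-cong< (suc m) λ { j (s≤s j≤m) →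
           *-cong (a≈a' i j i≤n j≤m) (b≈b' (n ∸ i) (m ∸ j) (ℕₚ.m∸n≤m n i) (ℕₚ.m∸n≤m m j)) } }) ⟩
    (a' ⊛ b') n m   ≈⟨ ≋-elim (⊛≋* a' b') n m ⟩
    (a' S.* b') n m  ∎
    where open SetoidReasoning setoid

  -- In each summand either r is taken at (0,0), where it vanishes, or the total degree left for s
  -- has dropped below t.
  order-mul : ∀ t r s → r 0 0 ≈ 0# → (∀ n m → n ℕ.+ m < t → s n m ≈ 0#) →
    ∀ n m → n ℕ.+ m < suc t → (r S.* s) n m ≈ 0#
  order-mul t r s r₀≈0 s≈0 n m (s≤s n+m≤t) = trans (sym (≋-elim (⊛≋* r s) n m))
    (sum-zero (suc n) λ { i (s≤s i≤n) → sum-zero (suc m) λ { j (s≤s j≤m) → term i j i≤n j≤m } })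
    where
    term : ∀ i j → i ≤ n → j ≤ m → r i j * s (n ∸ i) (m ∸ j) ≈ 0#
    term zero zero _ _ = trans (*-congʳ r₀≈0) (zeroˡ _)
    term (suc i) j i<n j≤m = trans (*-congˡ (s≈0 _ _ (ℕₚ.≤-trans
      (ℕₚ.+-mono-<-≤ (ℕₚ.∸-monoʳ-< (s≤s z≤n) i<n) (ℕₚ.m∸n≤m m j)) n+m≤t))) (zeroʳ _)
    term zero (suc j) _ j<m = trans (*-congˡ (s≈0 _ _ (ℕₚ.≤-trans
      (ℕₚ.+-monoʳ-< n (ℕₚ.∸-monoʳ-< (s≤s z≤n) j<m)) n+m≤t))) (zeroʳ _)

  order-^ : ∀ t r → r 0 0 ≈ 0# → ∀ n m → n ℕ.+ m < t → (r ^ᵖ t) n m ≈ 0#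
  order-^ (suc t) r r₀≈0 = order-mul t r (r ^ᵖ t) r₀≈0 (order-^ t r r₀≈0)

  geom : S.Carrier → S.Carrier
  geom r n m = sum (suc (n ℕ.+ m)) (λ t → (r ^ᵖ t) n m)

  geom-unique : ∀ {r g} (p : ℕ → S.Carrier) → (∀ t → p t ≋ r ^ᵖ t) →
    (∀ n m → g n m ≈ sum (suc (n ℕ.+ m)) (λ t → p t n m)) → g ≋ geom r
  geom-unique p p≋ g≈ = ≋-intro λ n m →
    trans (g≈ n m) (sum-cong (suc (n ℕ.+ m)) λ t → ≋-elim (p≋ t) n m)

  partialGeom : ℕ → S.Carrier → S.Carrier
  partialGeom N r n m = sum N (λ t → (r ^ᵖ t) n m)

  partialGeom-telescope : ∀ N r → (S.1# S.- r) S.* partialGeom N r ≋ S.1# S.- r ^ᵖ N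
  partialGeom-telescope zero    r = S.trans (S.zeroʳ _) (S.sym (S.-‿inverseʳ S.1#))
  partialGeom-telescope (suc N) r = S.trans (S.distribˡ (S.1# S.- r) (partialGeom N r) (r ^ᵖ N))
    (S.trans (S.+-congʳ (partialGeom-telescope N r))
      (solve 2 (λ r p → (con 1ℤ :- p) :+ (con 1ℤ :- r) :* p := con 1ℤ :- r :* p) S.refl r (r ^ᵖ N)))

  -- `geom` truncates each coefficient at its own bound. For the coefficient (n,m) all of them may
  -- be raised to the common bound N = n + m + 1; the sum then telescopes to 1 - r^N, and r^N has
  -- order above n + m.
  geom-inverse : ∀ r → r 0 0 ≈ 0# → (S.1# S.- r) S.* geom r ≋ S.1#
  geom-inverse r r₀≈0 = ≋-intro λ n m → begin
    ((S.1# S.- r) S.* geom r) n m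
      ≈⟨ *-local n m (λ _ _ _ _ → refl) (λ i j i≤n j≤m → sym (sum-extend (λ t → (r ^ᵖ t) i j)
           (ℕₚ.≤⇒≤′ (s≤s (ℕₚ.+-mono-≤ i≤n j≤m))) (λ t i+j<t → order-^ t r r₀≈0 i j i+j<t))) ⟩
    ((S.1# S.- r) S.* partialGeom (suc (n ℕ.+ m)) r) n m
      ≈⟨ ≋-elim (partialGeom-telescope (suc (n ℕ.+ m)) r) n m ⟩
    S.1# n m - (r ^ᵖ suc (n ℕ.+ m)) n m
      ≈⟨ +-congˡ (trans (-‿cong (order-^ (suc (n ℕ.+ m)) r r₀≈0 n m ℕₚ.≤-refl)) -0#≈0#) ⟩
    S.1# n m + 0#
      ≈⟨ +-identityʳ _ ⟩
    S.1# n m  ∎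
    where open SetoidReasoning setoid

  q : A.Carrier
  q = C⟦q⟧.var

  κ : Carrier → S.Carrier
  κ a = C⟦q,u⟧.ι (C⟦q⟧.ι a)

  -- Here ae = 1 - r, and the hypothesis says that r has no constant term.
  inverse-via-geom : ∀ e a → e * a 0 0 ≈ 1# → a S.* (κ e S.* geom (S.1# S.- κ e S.* a)) ≋ S.1#
  inverse-via-geom e a ea₀≈1 = S.trans
    (solve 3 (λ a e g → a :* (e :* g) := (con 1ℤ :- (con 1ℤ :- e :* a)) :* g) S.refl a (κ e) (geom r))
    (geom-inverse r r₀≈0)
    where
    r : S.Carrier
    r = S.1# S.- κ e S.* a
    r₀≈0 : r 0 0 ≈ 0#
    r₀≈0 = trans (+-congˡ (-‿cong ea₀≈1)) (-‿inverseʳ 1#)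

  qʲ-shift : ∀ j b m → ((q C⟦q⟧.^ᵖ j) A.* b) (j ℕ.+ m) ≈ b m
  qʲ-shift zero    b m = trans (C⟦q⟧.conv-ι m 1# b) (*-identityˡ _)
  qʲ-shift (suc j) b m = trans (C⟦q⟧.conv-assoc (suc j ℕ.+ m) q (q C⟦q⟧.^ᵖ j) b)
    (trans (C⟦q⟧.conv-var-suc (j ℕ.+ m) _) (qʲ-shift j b m))

  Double : Set c
  Double = S.Carrier

  one : Double
  one = S.1#

  infixl 7 _⊠_
  _⊠_ : Double → Double → Double
  _⊠_ = S._*_

  infix 9 q^_ u^_
  q^_ : ℕ → A.Carrier
  q^ k = q C⟦q⟧.^ᵖ k

  u^_ : ℕ → Double
  u^ k = C⟦q,u⟧.var ^ᵖ k

  infixr 8 _^^_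
  _^^_ : Double → ℕ → Double
  a ^^ k = a ^ᵖ k

  q-poch : ℕ → Double
  q-poch n = C⟦q,u⟧.ι (QPochhammer.qpoch A q n)

  sumUpTo : (ℕ → Double) → Double
  sumUpTo T n m = sum (suc n) (λ k → T k n m)

  sumUpTo-pointwise : ∀ T n m → sumUpTo T n m ≈ Sum.sum A (suc n) (λ k → T k n) m
  sumUpTo-pointwise T n m = sym (reflexive (sum-pointwise (suc n) (λ k → T k n) m))

  private
    dilate-q : ∀ k a n m → C⟦q,u⟧.dilate (q^ k) a n m ≈ (q^ (k ℕ.* n) A.* a n) m
    dilate-q k a n m = C⟦q⟧.coeff (A.*-congʳ {a n} (^-assocʳ q k n)) m
      where open Algebra.Properties.Semiring.Exp A.semiring using (^-assocʳ)

  dilate-q-above : ∀ k a n m → k ℕ.* n ≤ m → C⟦q,u⟧.dilate (q^ k) a n m ≈ a n (m ∸ k ℕ.* n)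
  dilate-q-above k a n m kn≤m = trans (dilate-q k a n m)
    (trans (reflexive (≡.cong (q^ (k ℕ.* n) A.* a n) (≡.sym (ℕₚ.m+[n∸m]≡n kn≤m))))
      (qʲ-shift (k ℕ.* n) (a n) (m ∸ k ℕ.* n)))

  dilate-q-below : ∀ k a n m → m < k ℕ.* n → C⟦q,u⟧.dilate (q^ k) a n m ≈ 0#
  dilate-q-below k a n m m<kn = trans (dilate-q k a n m) (C⟦q⟧.var-below m<kn (a n))

  q-poch-suc : ∀ n → q-poch n ⊠ (one S.- C⟦q,u⟧.ι (q^ suc n)) ≋ q-poch (suc n)
  q-poch-suc n = S.sym (S.trans (C⟦q,u⟧.ι-* (QPochhammer.qpoch A q n) (A.1# A.- q^ suc n))
    (S.*-congˡ {q-poch n} (S.trans (C⟦q,u⟧.ι-+ A.1# (A.- q^ suc n)) (S.+-congˡ {one} (C⟦q,u⟧.ι-‿- (q^ suc n))))))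

  q-poch-constant : ∀ n → q-poch n 0 0 ≈ 1#
  q-poch-constant zero    = refl
  q-poch-constant (suc n) = trans (*-cong (q-poch-constant n)
    (trans (+-congˡ (trans (-‿cong (zeroˡ _)) -0#≈0#)) (+-identityʳ 1#))) (*-identityˡ 1#)

  ι-q-monomial : ∀ {a : Double} f j → (∀ m → a (suc m) A.≈ A.0#) → a 0 j ≈ f → (∀ m → m ≢ j → a 0 m ≈ 0#) →
    a ≋ C⟦q,u⟧.ι (C⟦q⟧.ι f A.* q^ j)
  ι-q-monomial {a} f j a₊≈0 aⱼ≈f a≈0 = C⟦q,u⟧.coeffwise λ
    { zero    → C⟦q⟧.coeffwise λ m → trans (go m) (C⟦q⟧.conv-comm m (q^ j) (C⟦q⟧.ι f))
    ; (suc n) → a₊≈0 n }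
    where
    go : ∀ m → a 0 m ≈ (q^ j A.* C⟦q⟧.ι f) m
    go m with ℕₚ.<-cmp m j
    ... | tri< m<j m≢j _    = trans (a≈0 m m≢j) (sym (C⟦q⟧.var-below m<j (C⟦q⟧.ι f)))
    ... | tri≈ _ ≡.refl _   = trans aⱼ≈f (sym (C⟦q⟧.var-diag m (C⟦q⟧.ι f)))
    ... | tri> _ m≢j j<m    = trans (a≈0 m m≢j) (sym (C⟦q⟧.var-above j<m f))

  κ-intro : ∀ {a : Double} f → a 0 0 ≈ f → (∀ m → a 0 (suc m) ≈ 0#) → (∀ n m → a (suc n) m ≈ 0#) → a ≋ κ f
  κ-intro f a₀≈f a₀≈0 a₊≈0 = ≋-intro λ
    { zero zero → a₀≈f ; zero (suc m) → a₀≈0 m ; (suc n) m → a₊≈0 n m }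

  var-intro : ∀ {a : Double} → (∀ m → a 0 m ≈ 0#) → a 1 0 ≈ 1# → (∀ m → a 1 (suc m) ≈ 0#) →
    (∀ n m → a (suc (suc n)) m ≈ 0#) → a ≋ C⟦q,u⟧.var
  var-intro a₀≈0 a₁≈1 a₁≈0 a₊≈0 = ≋-intro λ
    { zero m → a₀≈0 m ; (suc zero) zero → a₁≈1 ; (suc zero) (suc m) → a₁≈0 m ; (suc (suc n)) m → a₊≈0 n m }

  one-minus-constant : ∀ {e : Double} ξ → e 0 0 ≈ 1# → (one S.- κ ξ ⊠ e) 0 0 ≈ 1# - ξ
  one-minus-constant ξ e₀≈1 = +-congˡ (-‿cong (trans (*-congˡ e₀≈1) (*-identityʳ ξ)))

  one-minus-var-constant : ∀ r (s : Double) → (one S.- κ r ⊠ (C⟦q,u⟧.var ⊠ s)) 0 0 ≈ 1#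
  one-minus-var-constant r s =
    trans (+-congˡ (trans (-‿cong (trans (*-congˡ (zeroˡ _)) (zeroʳ r))) -0#≈0#)) (+-identityʳ 1#)

  -- Substituting uq^k for u moves the coefficient of uⁿ up by kn places in q; the hypotheses are
  -- the two branches of `substU`.
  dilate-q-unique : ∀ k {a b : Double} → (∀ n m → k ℕ.* n ≤ m → b n m ≈ a n (m ∸ k ℕ.* n)) →
    (∀ n m → m < k ℕ.* n → b n m ≈ 0#) → b ≋ C⟦q,u⟧.dilate (q^ k) a
  dilate-q-unique k {a} {b} above below = ≋-intro go
    where
    go : ∀ n m → b n m ≈ C⟦q,u⟧.dilate (q^ k) a n m
    go n m with k ℕ.* n ℕ.≤? m
    ... | yes kn≤m = trans (above n m kn≤m) (sym (dilate-q-above k a n m kn≤m))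
    ... | no kn≰m  = trans (below n m (ℕₚ.≰⇒> kn≰m)) (sym (dilate-q-below k a n m (ℕₚ.≰⇒> kn≰m)))

-- The two formulas over an abstract coefficient ring.

module Cyclic {c ℓ c′ ℓ′ : Level} (K : CommutativeRing c ℓ) (β : CommutativeRing.Carrier K)
  (C : CommutativeRing c′ ℓ′)
  (ρ : CommutativeRing.Carrier K → CommutativeRing.Carrier C)
  (ρ-1 : CommutativeRing._≈_ C (ρ (CommutativeRing.1# K)) (CommutativeRing.1# C))
  (ρ-* : ∀ a b → CommutativeRing._≈_ C (ρ (CommutativeRing._*_ K a b)) (CommutativeRing._*_ C (ρ a) (ρ b)))
  (μ : Word → CommutativeRing.Carrier C)
  (μ-++ : ∀ v w → CommutativeRing._≈_ C (μ (v ++ w)) (CommutativeRing._*_ C (μ v) (μ w)))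
  (μ-up : ∀ w → CommutativeRing._≈_ C (μ (up w)) (μ w))
  (J : ℕ → DoubleSeries.Double C)
  (J-inverse : ∀ n → DoubleSeries._≋_ C (DoubleSeries._⊠_ C (DoubleSeries.q-poch C n) (J n)) (DoubleSeries.one C)) where
  open Cyc K β using (Elm; Dⁿ; gen)
  open DoubleSeries C
  open CommutativeRing C using (_≈_) renaming (Carrier to Coeff; trans to ≈-trans; sym to ≈-sym)
  open QPochhammer A q using (fromInverse; inverse-constant; sum-monomials)

  -- Only the part of `J n` constant in u is kept; `J-constant` shows that nothing is lost.
  I : InverseQPochhammer A q
  I = fromInverse (λ n → J n 0) (λ n → C⟦q,u⟧.coeff (J-inverse n) 0)

  open C⟦q⟧ using () renaming (ι to ιC)
  open C⟦q,u⟧ using (ι; ι-cong; ι-*; ι-+; ι-‿-; ι-^; var; _^ᵖ_; coeffwise; coeff; dilate; dilate-cong; dilate-*; dilate-+; dilate-‿-; dilate-ι; dilate-var)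
  open QDifference A q I
  open WordSeries K β A q I (λ a → ιC (ρ a)) (C⟦q⟧.ι-cong ρ-1)
    (λ a b → A.trans (C⟦q⟧.ι-cong (ρ-* a b)) (C⟦q⟧.ι-* (ρ a) (ρ b)))
    (λ w → ιC (μ w)) (λ v w → A.trans (C⟦q⟧.ι-cong (μ-++ v w)) (C⟦q⟧.ι-* (μ v) (μ w))) (λ w → C⟦q⟧.ι-cong (μ-up w))
  open Algebra.Properties.Semiring.Exp S.semiring using (^-congˡ)
  open Algebra.Properties.CommutativeSemiring.Exp S.commutativeSemiring using (^-distrib-*)
  open RingSolver S
  open SetoidReasoning S.setoid

  J-constant : ∀ n → J n ≋ ι (J n 0)
  J-constant n = inverse-constant (J-inverse n)

  value : Elm → A.Carrier
  value f = eval f (λ w → ιC (μ w))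

  letterSeries : Sym → ℕ → Double
  letterSeries = letter

  x̂ : Sym → Coeff
  x̂ s = μ (lt s 0 false ∷ [])

  sum-to-letter : ∀ s j {g} (T : ℕ → Double) → (∀ k → T k ≋ ι (value (Dⁿ k (gen s j))) S.* (u^ k S.* J k)) →
    (∀ n m → g n m ≈ sumUpTo T n m) → g ≋ letterSeries s j
  sum-to-letter s j {g} T T≋ g≈ = S.trans (≋-intro λ n m → ≈-trans (g≈ n m) (sumUpTo-pointwise T n m))
    (coeffwise λ n → A.trans
      (sum-monomials (λ k → S.trans (T≋ k) (S.*-congˡ (S.*-congˡ (J-constant k)))) n)
      (A.*-congʳ (value-gen n)))
    where
    w : Word
    w = lt s j false ∷ []
    value-gen : ∀ n → value (Dⁿ n (gen s j)) A.≈ D*ⁿ n (λ w → ιC (μ w)) w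
    value-gen n = A.trans (eval-Dⁿ n (gen s j) _) (A.trans (A.+-identityʳ _)
      (A.trans (A.*-congʳ (A.trans (A.*-identityʳ _) (C⟦q⟧.ι-cong ρ-1))) (A.*-identityˡ _)))

  expSeries : A.Carrier → Double
  expSeries = qexp

  sum-to-exp : ∀ a {g v} (T : ℕ → Double) → v ≋ ι a S.* var → (∀ k → T k ≋ (v ^^ k) S.* J k) →
    (∀ n m → g n m ≈ sumUpTo T n m) → g ≋ expSeries a
  sum-to-exp a {g} {v} T v≋ T≋ g≈ = S.trans (≋-intro λ n m → ≈-trans (g≈ n m) (sumUpTo-pointwise T n m))
    (coeffwise λ n → sum-monomials (λ k → begin
      T k                                        ≈⟨ T≋ k ⟩
      (v ^^ k) S.* J k                           ≈⟨ S.*-cong (^-congˡ k v≋) (J-constant k) ⟩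
      ((ι a S.* var) ^ᵖ k) S.* ι (J k 0)         ≈⟨ S.*-congʳ (^-distrib-* (ι a) var k) ⟩
      ((ι a ^ᵖ k) S.* u^ k) S.* ι (J k 0)        ≈⟨ S.*-assoc (ι a ^ᵖ k) (u^ k) _ ⟩
      (ι a ^ᵖ k) S.* (u^ k S.* ι (J k 0))        ≈⟨ S.*-congʳ (S.sym (ι-^ a k)) ⟩
      ι (a ^ᴬ k) S.* (u^ k S.* ι (J k 0))        ∎) n)
    where open Algebra.Properties.Semiring.Exp A.semiring using () renaming (_^_ to _^ᴬ_)

  expSeries-zero : ∀ a → expSeries a 0 0 ≈ CommutativeRing.1# C
  expSeries-zero a = C⟦q⟧.coeff (A.trans (A.*-identityˡ _) (InverseQPochhammer.i-zero I)) 0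

  Z₁ : letterSeries Z 1 ≋ dilate q (letterSeries Z 0)
  Z₁ = γ-up (lt Z 0 false ∷ [])

  dilate-Z₁ : ∀ k → dilate (q^ k) (letterSeries Z 1) ≋ dilate (q^ suc k) (letterSeries Z 0)
  dilate-Z₁ k = S.trans (dilate-cong (q^ k) Z₁) (dilate-dilate (q^ k) q _)

  Δx : Sym → Sym → A.Carrier
  Δx s t = ιC (x̂ s) A.- ιC (x̂ t)

  -- The closed form at u, dilated by qᵏ⁺¹: constants are unaffected, the argument of e_q is
  -- rescaled, and z₁(uqᵏ) = z₀(uqᵏ⁺¹) explains the extra power. The denominator stays on the left
  -- until it has been inverted.
  Z-closed-form : ∀ ξ → CommutativeRing._*_ C (x̂ X) ξ ≈ x̂ Y → ∀ k →
    dilate (q^ k) (letterSeries Z 1) S.* (S.1# S.- κ ξ S.* expSeries (q^ suc k A.* Δx X Y)) ≋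
    ι (Δx Z Y) S.+ κ ξ S.* (ι (Δx X Z) S.* expSeries (q^ suc k A.* Δx X Y))
  Z-closed-form ξ xξ≈y k = begin
    dilate (q^ k) (letterSeries Z 1) S.* (S.1# S.- κ ξ S.* expSeries (t A.* a))
      ≈⟨ S.*-cong (dilate-Z₁ k) (S.+-congˡ {S.1#} (S.-‿cong (S.*-congˡ {κ ξ} (S.sym (dilate-qexp t a))))) ⟩
    dilate t Ẑ S.* (S.1# S.- κ ξ S.* dilate t (qexp a))
      ≈⟨ S.*-congˡ {dilate t Ẑ} (S.+-cong (dilate-ι t A.1#)
           (S.trans (dilate-‿- t (κ ξ S.* qexp a)) (S.-‿cong (dilate-κ* (qexp a))))) ⟨
    dilate t Ẑ S.* (dilate t S.1# S.+ dilate t (S.- (κ ξ S.* qexp a)))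
      ≈⟨ S.*-congˡ {dilate t Ẑ} (dilate-+ t S.1# (S.- (κ ξ S.* qexp a))) ⟨
    dilate t Ẑ S.* dilate t (S.1# S.- κ ξ S.* qexp a)
      ≈⟨ dilate-* t Ẑ (S.1# S.- κ ξ S.* qexp a) ⟨
    dilate t (Ẑ S.* (S.1# S.- κ ξ S.* qexp a))
      ≈⟨ dilate-cong t closed-form ⟩
    dilate t (ι (Δx Z Y) S.+ κ ξ S.* (ι (Δx X Z) S.* qexp a))
      ≈⟨ dilate-+ t (ι (Δx Z Y)) (κ ξ S.* (ι (Δx X Z) S.* qexp a)) ⟩
    dilate t (ι (Δx Z Y)) S.+ dilate t (κ ξ S.* (ι (Δx X Z) S.* qexp a))
      ≈⟨ S.+-cong (dilate-ι t (Δx Z Y)) (S.trans (dilate-κ* (ι (Δx X Z) S.* qexp a)) (S.*-congˡ {κ ξ}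
           (S.trans (dilate-* t (ι (Δx X Z)) (qexp a)) (S.*-cong (dilate-ι t (Δx X Z)) (dilate-qexp t a))))) ⟩
    ι (Δx Z Y) S.+ κ ξ S.* (ι (Δx X Z) S.* expSeries (t A.* a))  ∎
    where
    t a : A.Carrier
    t = q^ suc k
    a = Δx X Y
    Ẑ : Double
    Ẑ = letterSeries Z 0
    dilate-κ* : ∀ b → dilate t (κ ξ S.* b) ≋ κ ξ S.* dilate t b
    dilate-κ* b = S.trans (dilate-* t (κ ξ) b) (S.*-congʳ (dilate-ι t (ιC ξ)))
    open Riccati (letter-zero X 0) (letter-zero Y 0) (letter-zero Z 0)
      (A.trans (A.sym (C⟦q⟧.ι-* (x̂ X) ξ)) (C⟦q⟧.ι-cong xξ≈y)) X-Δ Y-Δ Z-Δ using (closed-form)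

  -- The equation of e₀ dilated by qᵏ. The factor u becomes qᵏu, which is where qᵏ in the product
  -- comes from, and Z(qu) becomes z₁(uqᵏ).
  E-step : ∀ k → dilate (q^ k) (letterSeries E 0) S.*
      (S.1# S.- κ (ρ β) S.* (var S.* (ι (q^ k) S.* dilate (q^ k) (letterSeries Z 1)))) ≋
    dilate (q^ suc k) (letterSeries E 0)
  E-step k = Combinations.factor-out S (begin
    dilate t Ê S.- dilate (q^ suc k) Ê
      ≈⟨ S.+-congˡ (S.-‿cong (dilate-dilate t q Ê)) ⟨
    dilate t Ê S.- dilate t (dilate q Ê)
      ≈⟨ S.+-congˡ (dilate-‿- t (dilate q Ê)) ⟨
    dilate t Ê S.+ dilate t (S.- dilate q Ê)
      ≈⟨ dilate-+ t Ê (S.- dilate q Ê) ⟨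
    dilate t (Ê S.- dilate q Ê)
      ≈⟨ dilate-cong t E-Δ ⟩
    dilate t (var S.* (κ (ρ β) S.* (Ê S.* dilate q Ẑ)))
      ≈⟨ S.trans (dilate-* t var (κ (ρ β) S.* (Ê S.* dilate q Ẑ))) (S.*-cong (dilate-var t)
           (S.trans (dilate-* t (κ (ρ β)) (Ê S.* dilate q Ẑ)) (S.*-cong (dilate-ι t (ιC (ρ β)))
             (S.trans (dilate-* t Ê (dilate q Ẑ)) (S.*-congˡ {dilate t Ê} (dilate-cong t (S.sym Z₁))))))) ⟩
    (ι t S.* var) S.* (κ (ρ β) S.* (dilate t Ê S.* dilate t (letterSeries Z 1)))
      ≈⟨ solve 5 (λ t u b e z → (t :* u) :* (b :* (e :* z)) := u :* (b :* (e :* (t :* z)))) S.refl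
           (ι t) var (κ (ρ β)) (dilate t Ê) (dilate t (letterSeries Z 1)) ⟩
    var S.* (κ (ρ β) S.* (dilate t Ê S.* (ι t S.* dilate t (letterSeries Z 1))))  ∎)
    where
    t : A.Carrier
    t = q^ k
    Ê Ẑ : Double
    Ê = letterSeries E 0
    Ẑ = letterSeries Z 0

  -- The remainder e₀(uq^N) is kept as a factor, so the identity is exact for every N; nothing
  -- converges until the remainder is discarded modulo q^N.
  E-product : ∀ {F Π : ℕ → Double} →
    (∀ k → (S.1# S.- κ (ρ β) S.* (var S.* (ι (q^ k) S.* dilate (q^ k) (letterSeries Z 1)))) S.* F k ≋ S.1#) →
    Π 0 ≋ S.1# → (∀ N → Π (suc N) ≋ Π N S.* F N) →
    ∀ N → letterSeries E 0 ≋ dilate (q^ N) (letterSeries E 0) S.* Π N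
  E-product {F} {Π} F-inv Π₀ Π₊ zero = S.sym (S.trans (S.*-congˡ Π₀) (S.trans (S.*-identityʳ _)
    (coeffwise λ n → A.trans (A.*-congʳ (^-one n)) (A.*-identityˡ _))))
    where
    open Algebra.Properties.Semiring.Exp A.semiring using (_^_)
    ^-one : ∀ n → (A.1# ^ n) A.≈ A.1#
    ^-one zero    = A.refl
    ^-one (suc n) = A.trans (A.*-identityˡ _) (^-one n)
  E-product {F} {Π} F-inv Π₀ Π₊ (suc N) = begin
    Ê                                           ≈⟨ E-product {F} {Π} F-inv Π₀ Π₊ N ⟩
    dilate (q^ N) Ê S.* Π N                     ≈⟨ S.*-identityʳ _ ⟨
    (dilate (q^ N) Ê S.* Π N) S.* S.1#          ≈⟨ S.*-congˡ (F-inv N) ⟨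
    (dilate (q^ N) Ê S.* Π N) S.* (g S.* F N)
      ≈⟨ solve 4 (λ e p g f → (e :* p) :* (g :* f) := (e :* g) :* (p :* f)) S.refl (dilate (q^ N) Ê) (Π N) g (F N) ⟩
    (dilate (q^ N) Ê S.* g) S.* (Π N S.* F N)   ≈⟨ S.*-cong (E-step N) (S.sym (Π₊ N)) ⟩
    dilate (q^ suc N) Ê S.* Π (suc N)           ∎
    where
    Ê g : Double
    Ê = letterSeries E 0
    g = S.1# S.- κ (ρ β) S.* (var S.* (ι (q^ N) S.* dilate (q^ N) (letterSeries Z 1)))

  -- Modulo q^N only the constant term in u of e₀(u q^N) survives.
  E-truncated : ∀ {Π N} → letterSeries E 0 ≋ dilate (q^ N) (letterSeries E 0) S.* Π →
    ∀ n m → m < N → letterSeries E 0 n m ≈ (κ (x̂ E) S.* Π) n m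
  E-truncated {Π} {N} e n m m<N = ≈-trans (≋-elim e n m)
    (*-local n m {b = Π} (λ i j _ j≤m → low i j (ℕₚ.≤-trans (s≤s j≤m) m<N)) λ _ _ _ _ → CommutativeRing.refl C)
    where
    low : ∀ i j → j < N → dilate (q^ N) (letterSeries E 0) i j ≈ κ (x̂ E) i j
    low zero    j _   = C⟦q⟧.coeff (A.trans (A.*-identityˡ _) (letter-zero E 0)) j
    -- The dilation contributes q to the power N(i + 1), which is at least N and so exceeds j.
    low (suc i) j j<N = dilate-q-below N (letterSeries E 0) (suc i) j
      (ℕₚ.<-≤-trans j<N (ℕₚ.m≤m*n N (suc i)))

  value-[] : κ (CommutativeRing.0# C) ≋ ι (value [])
  value-[] = ι-cong C⟦q⟧.ι-0

  value-∷ : ∀ {b j w f g} {t φf : Double} → t ≋ ι (ιC g A.* q^ j) → g ≈ CommutativeRing._*_ C (ρ b) (μ w) →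
    φf ≋ ι (value f) → t S.+ φf ≋ ι (value (Cyc.tm b j w ∷ f))
  value-∷ {b} {j} {w} {f} {g} t≋ g≈ φf≋ = S.trans (S.+-cong (S.trans t≋ (ι-cong (A.trans
      (A.*-congʳ (A.trans (C⟦q⟧.ι-cong g≈) (C⟦q⟧.ι-* (ρ b) (μ w))))
      (solveᴬ 3 (λ r m s → (r :×: m) :×: s ≔ (r :×: s) :×: m) A.refl (ιC (ρ b)) (ιC (μ w)) (q^ j))))) φf≋)
    (S.sym (ι-+ (ιC (ρ b) A.* q^ j A.* ιC (μ w)) (value f)))
    where open RingSolver A using () renaming (solve to solveᴬ; _:*_ to _:×:_; _:=_ to _≔_)

  value-gen₀ : ∀ s → ι (value (gen s 0)) ≋ κ (x̂ s)
  value-gen₀ s = ι-cong (A.trans (A.+-identityʳ _)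
    (A.trans (A.*-congʳ (A.trans (A.*-identityʳ _) (C⟦q⟧.ι-cong ρ-1))) (A.*-identityˡ _)))

  ι-Δx : ∀ s t → κ (x̂ s) S.- κ (x̂ t) ≋ ι (Δx s t)
  ι-Δx s t = S.sym (S.trans (ι-+ (ιC (x̂ s)) (A.- ιC (x̂ t))) (S.+-congˡ (ι-‿- (ιC (x̂ t)))))

  exp-argument : ∀ s t j → (κ (x̂ s) S.- κ (x̂ t)) S.* (var S.* ι (q^ j)) ≋ ι (q^ j A.* Δx s t) S.* var
  exp-argument s t j = begin
    (κ (x̂ s) S.- κ (x̂ t)) S.* (var S.* ι (q^ j))  ≈⟨ S.*-congʳ (ι-Δx s t) ⟩
    ι (Δx s t) S.* (var S.* ι (q^ j))              ≈⟨ solve 3 (λ d u q → d :* (u :* q) := (q :* d) :* u) S.refl (ι (Δx s t)) var (ι (q^ j)) ⟩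
    (ι (q^ j) S.* ι (Δx s t)) S.* var              ≈⟨ S.*-congʳ (ι-* (q^ j) (Δx s t)) ⟨
    ι (q^ j A.* Δx s t) S.* var                    ∎

  divide : ∀ {a b n i : Double} → a S.* b ≋ n → b S.* i ≋ S.1# → a ≋ n S.* i
  divide {a} {b} {n} {i} ab≋n bi≋1 = begin
    a                ≈⟨ S.*-identityʳ a ⟨
    a S.* S.1#       ≈⟨ S.*-congˡ bi≋1 ⟨
    a S.* (b S.* i)  ≈⟨ S.*-assoc a b i ⟨
    (a S.* b) S.* i  ≈⟨ S.*-congʳ ab≋n ⟩
    n S.* i          ∎

-- Transfer to the concrete fractions and series of the definitions.

wordExp-++ : ∀ v w → wordExp (v ++ w) ≡ wordExp v +E wordExp w
wordExp-++ []      w = ≡.sym (+E-identityˡ (wordExp w))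
wordExp-++ (l ∷ v) w = ≡.trans (≡.cong (letterExp l +E_) (wordExp-++ v w))
  (≡.sym (+E-assoc (letterExp l) (wordExp v) (wordExp w)))

letterExp-idx : ∀ s j k b → letterExp (lt s j b) ≡ letterExp (lt s k b)
letterExp-idx X j k b = ≡.refl
letterExp-idx Y j k b = ≡.refl
letterExp-idx Z j k b = ≡.refl
letterExp-idx E j k b = ≡.refl

wordExp-up : ∀ w → wordExp (up w) ≡ wordExp w
wordExp-up []               = ≡.refl
wordExp-up (lt s j b ∷ w) = ≡.cong₂ _+E_ (letterExp-idx s (suc j) j b) (wordExp-up w)

module Bridge {c ℓ : Level} (K : CommutativeRing c ℓ) (β : CommutativeRing.Carrier K) where
  open Cyc K β
  module K = CommutativeRing K
  open Laurent K β using (paired)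
  open Fractions K β
  open CrossMultiplication (Laurent.laurentRing K β) using (cross-one)
  private
    C = fractionRing
  module C = CommutativeRing C
  open DoubleSeries C
  open Sum C using (sum)
  open C⟦q,u⟧ using (ι; var; dilate)
  sumC≈sum : ∀ n {f g} → (∀ i → f i ≈ᶠ g i) → sumC n f ≈ᶠ sum n g
  sumC≈sum zero    f≈g = C.refl
  sumC≈sum (suc n) {f} {g} f≈g = +C-cong {sumC n f} {sum n g} {f n} {g n} (sumC≈sum n f≈g) (f≈g n)

  *S≋ : ∀ a b → a *S b ≋ a S.* b
  *S≋ a b = S.trans {a *S b} {a ⊛ b} {a S.* b} (≋-intro λ n m →
      sumC≈sum (suc n) λ i → sumC≈sum (suc m) λ j → C.refl)
    (⊛≋* a b)

  *S-cong : ∀ {a a' b b'} → a ≋ a' → b ≋ b' → a *S b ≋ a' S.* b'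
  *S-cong {a} {a'} {b} {b'} a≋a' b≋b' = S.trans (*S≋ a b) (S.*-cong a≋a' b≋b')

  constS≋ : ∀ f → constS f ≋ κ f
  constS≋ f = κ-intro {constS f} f C.refl (λ _ → C.refl) (λ _ _ → C.refl)

  1S≋ : 1S ≋ S.1#
  1S≋ = constS≋ 1C

  monoS≋ : ∀ f j → monoS f 0 j ≋ ι (C⟦q⟧.ι f A.* q^ j)
  monoS≋ f j = ι-q-monomial {monoS f 0 j} f j (λ n → C⟦q⟧.coeffwise (above n)) diag off
    where
    above : ∀ n m → monoS f 0 j (suc n) m ≈ᶠ 0C
    above n m with m ℕ.≡ᵇ j
    ... | true  = C.refl
    ... | false = C.refl
    diag : monoS f 0 j 0 j ≈ᶠ f
    diag with j ℕ.≡ᵇ j in eq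
    ... | true  = C.refl
    ... | false = ⊥-elim (≡.subst IsTrue eq (ℕₚ.≡⇒≡ᵇ j j ≡.refl))
    off : ∀ m → m ≢ j → monoS f 0 j 0 m ≈ᶠ 0C
    off m m≢j with m ℕ.≡ᵇ j in eq
    ... | true  = ⊥-elim (m≢j (ℕₚ.≡ᵇ⇒≡ m j (≡.subst IsTrue (≡.sym eq) tt)))
    ... | false = C.refl

  qPow≋ : ∀ j → qPow j ≋ ι (q^ j)
  qPow≋ j = S.trans {qPow j} {ι (C⟦q⟧.ι 1C A.* q^ j)} {ι (q^ j)} (monoS≋ 1C j)
    (C⟦q,u⟧.ι-cong {C⟦q⟧.ι 1C A.* q^ j} {q^ j} (A.*-identityˡ (q^ j)))

  uS≋ : uS ≋ var
  uS≋ = var-intro {uS} (λ _ → C.refl) C.refl (λ _ → C.refl) (λ _ _ → C.refl)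

  powS≋ : ∀ {a b} → a ≋ b → ∀ t → powS a t ≋ b ^^ t
  powS≋ a≋b zero    = 1S≋
  powS≋ {a} {b} a≋b (suc t) = *S-cong {a} {b} {powS a t} {b ^^ t} a≋b (powS≋ a≋b t)

  geomS≋ : ∀ {r r'} → r ≋ r' → geomS r ≋ geom r'
  geomS≋ {r} {r'} r≋r' = geom-unique {r'} {geomS r} (powS r) (powS≋ {r} {r'} r≋r')
    λ n m → sumC≈sum (suc (n ℕ.+ m)) λ t → C.refl

  -S-cong : ∀ {a a' b b'} → a ≋ a' → b ≋ b' → a -S b ≋ a' S.- b'
  -S-cong {a} {a'} {b} {b'} a≋a' b≋b' = S.+-cong {a} {a'} {S.- b} {S.- b'} a≋a' (S.-‿cong {b} {b'} b≋b')

  -- The ratio r is tied to 1 - fb only by equality of series, so that it may be an expression that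
  -- cannot be named, such as the one inside `closedForm`.
  geomS-inverse : ∀ f {r b} → r ≋ one S.- κ f ⊠ b → f *C b 0 0 ≈ᶠ 1C → b ⊠ (constS f *S geomS r) ≋ one
  geomS-inverse f {r} {b} r≋ fb₀≈1 = S.trans {b ⊠ (constS f *S geomS r)} {b ⊠ (κ f ⊠ geom r̂)} {one}
    (S.*-congˡ {b} {constS f *S geomS r} {κ f ⊠ geom r̂}
      (*S-cong {constS f} {κ f} {geomS r} {geom r̂} (constS≋ f) (geomS≋ {r} {r̂} r≋)))
    (inverse-via-geom f b fb₀≈1)
    where
    r̂ : Ser
    r̂ = one S.- κ f ⊠ b

  1-constS*≋ : ∀ f {a b} → a ≋ b → 1S -S (constS f *S a) ≋ one S.- κ f ⊠ b
  1-constS*≋ f {a} {b} a≋b =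
    -S-cong {1S} {one} {constS f *S a} {κ f ⊠ b} 1S≋ (*S-cong {constS f} {κ f} {a} {b} (constS≋ f) a≋b)

  invWith-inverse : ∀ f {a b} → a ≋ b → f *C b 0 0 ≈ᶠ 1C → b ⊠ invWith f a ≋ one
  invWith-inverse f {a} {b} a≋b = geomS-inverse f {1S -S (constS f *S a)} {b} (1-constS*≋ f {a} {b} a≋b)

  invWith-1C-inverse : ∀ {a b} → a ≋ b → b 0 0 ≈ᶠ 1C → b ⊠ invWith (Cyc.1C K β) a ≋ one
  invWith-1C-inverse {a} {b} a≋b b₀≈1 = invWith-inverse (Cyc.1C K β) {a} {b} a≋b
    (≈ᶠ-trans {1C *C b 0 0} {b 0 0} {1C} (*C-identityˡ (b 0 0)) b₀≈1)

  substU-above : ∀ k a n m → k ℕ.* n ≤ m → substU k a n m ≡ a n (m ∸ k ℕ.* n)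
  substU-above k a n m kn≤m with k ℕ.* n ℕ.≤ᵇ m in eq
  ... | true  = ≡.refl
  ... | false = ⊥-elim (≡.subst IsTrue eq (ℕₚ.≤⇒≤ᵇ kn≤m))

  substU-below : ∀ k a n m → m < k ℕ.* n → substU k a n m ≡ 0C
  substU-below k a n m m<kn with k ℕ.* n ℕ.≤ᵇ m in eq
  ... | true  = ⊥-elim (ℕₚ.<⇒≱ m<kn (ℕₚ.≤ᵇ⇒≤ (k ℕ.* n) m (≡.subst IsTrue (≡.sym eq) tt)))
  ... | false = ≡.refl

  substU≋ : ∀ k {a b} → a ≋ b → substU k a ≋ dilate (q^ k) b
  substU≋ k {a} {b} a≋b = S.trans {substU k a} {dilate (q^ k) a} {dilate (q^ k) b}
    (dilate-q-unique k {a} {substU k a} (λ n m kn≤m → C.reflexive (substU-above k a n m kn≤m))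
      (λ n m m<kn → C.reflexive (substU-below k a n m m<kn)))
    (C⟦q,u⟧.dilate-cong (q^ k) {a} {b} a≋b)

  qPoch≋ : ∀ n → qPoch n ≋ q-poch n
  qPoch≋ zero    = 1S≋
  qPoch≋ (suc n) = S.trans {qPoch (suc n)} {q-poch n ⊠ (one S.- ι (q^ suc n))} {q-poch (suc n)}
    (*S-cong {qPoch n} {q-poch n} {1S -S qPow (suc n)} {one S.- ι (q^ suc n)} (qPoch≋ n)
      (-S-cong {1S} {one} {qPow (suc n)} {ι (q^ suc n)} 1S≋ (qPow≋ (suc n))))
    (q-poch-suc n)

  invQPoch-inverse : ∀ n → q-poch n ⊠ invQPoch n ≋ one
  invQPoch-inverse n = invWith-1C-inverse {qPoch n} {q-poch n} (qPoch≋ n) (q-poch-constant n)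

  scalar : K.Carrier → Frac
  scalar a = monoL a 0E /d^ 0

  wordMono : Word → Frac
  wordMono w = monoL K.1# (wordExp w) /d^ 0

  mono-cong : ∀ {a b m m'} → a K.≈ b → m ≡ m' → monoL a m /d^ 0 ≈ᶠ monoL b m' /d^ 0
  mono-cong a≈b ≡.refl = num-cong (paired λ f → K.+-congʳ (K.*-congʳ a≈b)) ≡.refl

  open Cyclic K β C scalar C.refl (λ a b → C.refl) wordMono
    (λ v w → mono-cong (K.sym (K.*-identityˡ K.1#)) (wordExp-++ v w))
    (λ w → mono-cong K.refl (wordExp-up w)) invQPoch invQPoch-inverse

  φ≋ : ∀ f → φ f ≋ ι (value f)
  φ≋ []             = S.trans {0S} {κ 0C} {ι (value [])} (constS≋ 0C) value-[]
  φ≋ (tm b j w ∷ f) = value-∷ {b} {j} {w} {f} {monoL b (wordExp w) /d^ 0} {φT (tm b j w)} {φ f}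
    (monoS≋ (monoL b (wordExp w) /d^ 0) j)
    (mono-cong (K.sym (K.*-identityʳ b)) (≡.sym (+E-identityˡ (wordExp w)))) (φ≋ f)

  sumU≈ : ∀ T n m → sumU T n m ≈ᶠ sumUpTo T n m
  sumU≈ T n m = sumC≈sum (suc n) λ k → C.refl

  φGen≋ : ∀ s j → Cyc.φGen K β (Cyc.gen K β s j) ≋ letterSeries s j
  φGen≋ s j = sum-to-letter s j {Cyc.φGen K β (Cyc.gen K β s j)} T T≋ (sumU≈ T)
    where
    T : ℕ → Ser
    T k = Cyc._*S_ K β (Cyc.φ K β (Cyc.Dⁿ K β k (Cyc.gen K β s j)))
            (Cyc._*S_ K β (Cyc.powS K β (Cyc.uS K β) k) (Cyc.invQPoch K β k))
    T≋ : ∀ k → T k ≋ ι (value (Dⁿ k (gen s j))) ⊠ (u^ k ⊠ invQPoch k)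
    T≋ k = *S-cong {φ (Dⁿ k (gen s j))} {ι (value (Dⁿ k (gen s j)))} {powS uS k *S invQPoch k} {u^ k ⊠ invQPoch k}
      (φ≋ (Dⁿ k (gen s j)))
      (*S-cong {powS uS k} {u^ k} {invQPoch k} {invQPoch k} (powS≋ {uS} {var} uS≋ k) (S.refl {invQPoch k}))

  symS≋ : ∀ s → Cyc.symS K β s ≋ κ (x̂ s)
  symS≋ s = S.trans {Cyc.symS K β s} {ι (value (gen s 0))} {κ (x̂ s)} (φ≋ (gen s 0)) (value-gen₀ s)

  eq≋ : ∀ {v} a → v ≋ ι a ⊠ var → eq v ≋ expSeries a
  eq≋ {v} a v≋ = sum-to-exp a {eq v} {v} T v≋
    (λ n → *S-cong {powS v n} {v ^^ n} {invQPoch n} {invQPoch n} (powS≋ {v} {v} (S.refl {v}) n) (S.refl {invQPoch n}))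
    (sumU≈ T)
    where
    T : ℕ → Ser
    T n = powS v n *S invQPoch n

  -- The names of Cyc are used instead of their opened copies wherever a term
  -- has to agree syntactically with one unfolded from the definitions: any
  -- mismatch makes the conversion checker compare the nested sums of _*S_
  -- coefficient by coefficient, which does not terminate in reasonable time.
  factor-form : ℕ → Ser → Ser
  factor-form k a = Cyc._-S_ K β (Cyc.1S K β)
    (Cyc._*S_ K β (Cyc.βS K β) (Cyc._*S_ K β (Cyc.uS K β) (Cyc._*S_ K β (Cyc.qPow K β k) a)))

  factor-form≋ : ∀ k {a b} → a ≋ b → factor-form k a ≋ one S.- κ (scalar β) ⊠ (var ⊠ (ι (q^ k) ⊠ b))
  factor-form≋ k {a} {b} a≋b =
    -S-cong {1S} {one} {βS *S (uS *S (qPow k *S a))} {κ (scalar β) ⊠ (var ⊠ (ι (q^ k) ⊠ b))} 1S≋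
      (*S-cong {βS} {κ (scalar β)} {uS *S (qPow k *S a)} {var ⊠ (ι (q^ k) ⊠ b)} (constS≋ (scalar β))
        (*S-cong {uS} {var} {qPow k *S a} {ι (q^ k) ⊠ b} uS≋
          (*S-cong {qPow k} {ι (q^ k)} {a} {b} (qPow≋ k) a≋b)))

  factor-form-inverse : ∀ k {a b} → a ≋ b →
    (one S.- κ (scalar β) ⊠ (var ⊠ (ι (q^ k) ⊠ b))) ⊠ Cyc.invWith K β (Cyc.1C K β) (factor-form k a) ≋ one
  factor-form-inverse k {a} {b} a≋b = invWith-1C-inverse
    {factor-form k a} {one S.- κ (scalar β) ⊠ (var ⊠ (ι (q^ k) ⊠ b))} (factor-form≋ k {a} {b} a≋b)
    (one-minus-var-constant (scalar β) (ι (q^ k) ⊠ b))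

  factor-inverse : ∀ k →
    (one S.- κ (scalar β) ⊠ (var ⊠ (ι (q^ k) ⊠ dilate (q^ k) (letterSeries Z 1)))) ⊠ Cyc.factor K β k ≋ one
  factor-inverse k = factor-form-inverse k
    {Cyc.substU K β k (Cyc.φGen K β (Cyc.gen K β Z 1))} {dilate (q^ k) (letterSeries Z 1)}
    (substU≋ k {Cyc.φGen K β (Cyc.gen K β Z 1)} {letterSeries Z 1} (φGen≋ Z 1))

  product-formula : ∀ N n m → m < N →
    Cyc.φGen K β (Cyc.gen K β E 0) n m ≈ᶠ Cyc._*S_ K β (Cyc.symS K β E) (Cyc.partialProd K β N) n m
  product-formula N n m m<N = from-truncation
    {Cyc.φGen K β (Cyc.gen K β E 0)} {Cyc.symS K β E} {Cyc.partialProd K β N} (φGen≋ E 0) (symS≋ E)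
    (E-truncated {Cyc.partialProd K β N} {N} (E-product {Cyc.factor K β} {Cyc.partialProd K β} factor-inverse 1S≋
      (λ M → *S≋ (Cyc.partialProd K β M) (Cyc.factor K β M)) N) n m m<N)
    where
    from-truncation : ∀ {g s p} → g ≋ letterSeries E 0 → s ≋ κ (x̂ E) →
      letterSeries E 0 n m ≈ᶠ (κ (x̂ E) ⊠ p) n m → g n m ≈ᶠ (s *S p) n m
    from-truncation {g} {s} {p} g≋ s≋ e = ≈ᶠ-trans {g n m} {letterSeries E 0 n m} {(s *S p) n m}
      (≋-elim {g} {letterSeries E 0} g≋ n m)
      (≈ᶠ-trans {letterSeries E 0 n m} {(κ (x̂ E) ⊠ p) n m} {(s *S p) n m} e
        (≋-elim {κ (x̂ E) ⊠ p} {s *S p} (S.sym {s *S p} {κ (x̂ E) ⊠ p}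
          (*S-cong {s} {κ (x̂ E)} {p} {p} s≋ (S.refl {p}))) n m))

  module _ (k : ℕ) where
    private
      Eq numer denom e n̂ d̂ : Ser
      Eq    = Cyc.eq K β (Cyc._*S_ K β (Cyc._-S_ K β (Cyc.symS K β X) (Cyc.symS K β Y))
                (Cyc._*S_ K β (Cyc.uS K β) (Cyc.qPow K β (suc k))))
      numer = Cyc._+S_ K β (Cyc._-S_ K β (Cyc.symS K β Z) (Cyc.symS K β Y))
                (Cyc._*S_ K β (Cyc.x⁻¹yS K β) (Cyc._*S_ K β (Cyc._-S_ K β (Cyc.symS K β X) (Cyc.symS K β Z)) Eq))
      denom = Cyc._-S_ K β (Cyc.1S K β) (Cyc._*S_ K β (Cyc.x⁻¹yS K β) Eq)
      e = expSeries (q^ suc k A.* Δx X Y)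
      ξ : Frac
      ξ = monoL K.1# (-1ℤ , 1ℤ , 0ℤ , 0ℤ) /d^ 0
      n̂ = ι (Δx Z Y) S.+ κ ξ ⊠ (ι (Δx X Z) ⊠ e)
      d̂ = one S.- κ ξ ⊠ e

      Δ≋ : ∀ s t → symS s -S symS t ≋ ι (Δx s t)
      Δ≋ s t = S.trans {symS s -S symS t} {κ (x̂ s) S.- κ (x̂ t)} {ι (Δx s t)}
        (-S-cong {symS s} {κ (x̂ s)} {symS t} {κ (x̂ t)} (symS≋ s) (symS≋ t)) (ι-Δx s t)

      Eq≋ : Eq ≋ e
      Eq≋ = eq≋ {(symS X -S symS Y) *S (Cyc.uS K β *S qPow (suc k))} (q^ suc k A.* Δx X Y)
        (S.trans {(symS X -S symS Y) *S (Cyc.uS K β *S qPow (suc k))} {(κ (x̂ X) S.- κ (x̂ Y)) ⊠ (var ⊠ ι (q^ suc k))}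
          {ι (q^ suc k A.* Δx X Y) ⊠ var}
          (*S-cong {symS X -S symS Y} {κ (x̂ X) S.- κ (x̂ Y)} {Cyc.uS K β *S qPow (suc k)} {var ⊠ ι (q^ suc k)}
            (-S-cong {symS X} {κ (x̂ X)} {symS Y} {κ (x̂ Y)} (symS≋ X) (symS≋ Y))
            (*S-cong {Cyc.uS K β} {var} {qPow (suc k)} {ι (q^ suc k)} uS≋ (qPow≋ (suc k))))
          (exp-argument X Y (suc k)))

      x⁻¹yS≋ : Cyc.x⁻¹yS K β ≋ κ ξ
      x⁻¹yS≋ = constS≋ ξ

      numer≋ : numer ≋ n̂
      numer≋ = S.+-cong {symS Z -S symS Y} {ι (Δx Z Y)} {Cyc.x⁻¹yS K β *S ((symS X -S symS Z) *S Eq)} {κ ξ ⊠ (ι (Δx X Z) ⊠ e)}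
        (Δ≋ Z Y)
        (*S-cong {Cyc.x⁻¹yS K β} {κ ξ} {(symS X -S symS Z) *S Eq} {ι (Δx X Z) ⊠ e} x⁻¹yS≋
          (*S-cong {symS X -S symS Z} {ι (Δx X Z)} {Eq} {e} (Δ≋ X Z) Eq≋))

      denom≋ : denom ≋ d̂
      denom≋ = -S-cong {Cyc.1S K β} {one} {Cyc.x⁻¹yS K β *S Eq} {κ ξ ⊠ e} 1S≋
        (*S-cong {Cyc.x⁻¹yS K β} {κ ξ} {Eq} {e} x⁻¹yS≋ Eq≋)

      c⁻¹ : Frac
      c⁻¹ = Cyc.1L K β /d^ 1

      -- As e_q(0) = 1, the constant term of the denominator is 1 - x⁻¹y, and its inverse is the
      -- fraction with numerator 1 and a single power of `dL`.
      d̂-constant : c⁻¹ *C d̂ 0 0 ≈ᶠ 1C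
      d̂-constant = ≈ᶠ-trans {c⁻¹ *C d̂ 0 0} {c⁻¹ *C (1C +C (-C ξ))} {1C}
        (*C-cong {c⁻¹} {c⁻¹} {d̂ 0 0} {1C +C (-C ξ)} C.refl
          (one-minus-constant {e} ξ (expSeries-zero (q^ suc k A.* Δx X Y))))
        (crossed (cross-one (monoL (K.- K.1#) (-1ℤ , 1ℤ , 0ℤ , 0ℤ))))

      xξ≈y : x̂ X *C ξ ≈ᶠ x̂ Y
      xξ≈y = mono-cong (K.*-identityˡ K.1#) ≡.refl

      -- The first hypothesis only serves to infer f, by unification of the
      -- denominators, so that the local definitions inside closedForm, which
      -- have no accessible names, need not be written out.
      sumC-via : ∀ n {x d} {f : ℕ → Frac} (g : ℕ → Frac) → Frac.den x ≡ Frac.den (sumC n f) ℕ.+ d →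
        x ≡ sumC (suc n) f → (∀ i → f i ≈ᶠ g i) → x ≈ᶠ sum (suc n) g
      sumC-via n g _ ≡.refl f≈g = sumC≈sum (suc n) f≈g

      -- `closedForm` as a double sum with the ratio r of its geometric series left open: r is found
      -- by unification and compared with the expected expression one coefficient at a time.
      Unfolding : Set (c ⊔ ℓ)
      Unfolding = Σ Ser λ r →
        (∀ n m → Cyc.closedForm K β k n m ≈ᶠ (numer ⊛ (constS (Cyc.1L K β /d^ 1) *S geomS r)) n m) ×
        (∀ n m → r n m ≡ (Cyc.1S K β -S (constS (Cyc.1L K β /d^ 1) *S denom)) n m)

      closedForm-from : Unfolding → Cyc.substU K β k (Cyc.φGen K β (Cyc.gen K β Z 1)) ≋ Cyc.closedForm K β k
      closedForm-from (r , closedForm≈ , r≡) = S.trans {Cyc.substU K β k (Cyc.φGen K β (Cyc.gen K β Z 1))} {Ẑ} {Cyc.closedForm K β k}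
        (substU≋ k {Cyc.φGen K β (Cyc.gen K β Z 1)} {letterSeries Z 1} (φGen≋ Z 1))
        (S.trans {Ẑ} {n̂ ⊠ inv} {Cyc.closedForm K β k}
          (divide {Ẑ} {d̂} {n̂} {inv} (Z-closed-form ξ xξ≈y k) (geomS-inverse c⁻¹ {r} {d̂} r≋ d̂-constant))
          (S.sym {Cyc.closedForm K β k} {n̂ ⊠ inv}
            (S.trans {Cyc.closedForm K β k} {numer ⊛ inv} {n̂ ⊠ inv} (≋-intro {Cyc.closedForm K β k} {numer ⊛ inv} closedForm≈)
              (S.trans {numer ⊛ inv} {numer ⊠ inv} {n̂ ⊠ inv} (⊛≋* numer inv)
                (S.*-congʳ {inv} {numer} {n̂} numer≋)))))
        where
        Ẑ inv : Ser
        Ẑ = dilate (q^ k) (letterSeries Z 1)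
        inv = constS c⁻¹ *S geomS r
        r≋ : r ≋ one S.- κ c⁻¹ ⊠ d̂
        r≋ = S.trans {r} {1S -S (constS c⁻¹ *S denom)} {one S.- κ c⁻¹ ⊠ d̂}
          (≋-intro {r} {1S -S (constS c⁻¹ *S denom)} λ n m → ≡⇒≈ᶠ (r≡ n m)) (1-constS*≋ c⁻¹ {denom} {d̂} denom≋)

      unfolded : Unfolding
      unfolded = _ ,
        (λ n m → sumC-via n {Cyc.closedForm K β k n m}
          (λ i → sum (suc m) (λ j → numer i j *C (constS (Cyc.1L K β /d^ 1) *S geomS _) (n ∸ i) (m ∸ j))) ≡.refl ≡.refl
          λ i → sumC-via m (λ j → numer i j *C (constS (Cyc.1L K β /d^ 1) *S geomS _) (n ∸ i) (m ∸ j)) ≡.refl ≡.refl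
          λ j → ≡⇒≈ᶠ ≡.refl) ,
        λ n m → ≡.refl

    closedForm≈ : ∀ n m →
      Cyc.substU K β k (Cyc.φGen K β (Cyc.gen K β Z 1)) n m ≈ᶠ Cyc.closedForm K β k n m
    closedForm≈ = ≋-elim {Cyc.substU K β k (Cyc.φGen K β (Cyc.gen K β Z 1))} {Cyc.closedForm K β k}
      (closedForm-from unfolded)

theorem5p9 : ∀ {c ℓ} (K : CommutativeRing c ℓ) → CharZero K → (β : CommutativeRing.Carrier K) →
    let open Cyc K β in
    (∀ (N n m : ℕ) → m < N →
    φGen (gen E 0) n m ≈C (symS E *S partialProd N) n m)
    × (∀ (k : ℕ) → substU k (φGen (gen Z 1)) ≈S closedForm k)
theorem5p9 K _ β =
  (λ N n m m<N → Fractions.≈ᶠ⇒≈C K β {Cyc.φGen K β (Cyc.gen K β E 0) n m}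
    {Cyc._*S_ K β (Cyc.symS K β E) (Cyc.partialProd K β N) n m} (Bridge.product-formula K β N n m m<N)) ,
  (λ k n m → Fractions.≈ᶠ⇒≈C K β {Cyc.substU K β k (Cyc.φGen K β (Cyc.gen K β Z 1)) n m}
    {Cyc.closedForm K β k n m} (Bridge.closedForm≈ K β k n m))
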